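{- Let $n\ge 3$ and $N=\binom{n}{2}$. For every $\pi\in\mathcal{S}_n$ let $v_\pi\in\mathbb{R}^N$ be the vector with coordinates $v_\pi(i,j)=1$ if $\pi(i)>\pi(j)$ and $v_\pi(i,j)=-1$ if $\pi(i)<\pi(j)$, for $1\le i<j\le n$, and let $\widetilde{\operatorname{LO}}_n=\operatorname{conv}\{v_\pi:\pi\in\mathcal{S}_n\}$. Then the group of Euclidean automorphisms of $\widetilde{\operatorname{LO}}_n$ is exactly $\{\pm R_\sigma:\sigma\in\mathcal{S}_n\}$, generated by relabelings and dualization, and it is isomorphic to $\mathbb{Z}_2\times\mathcal{S}_n$.
   Context: Extend coordinates of $v\in\mathbb{R}^N$ to all ordered pairs $i\ne j$ by $v(j,i)=-v(i,j)$. For $\sigma\in\mathcal{S}_n$ the relabeling $R_\sigma:\mathbb{R}^N\to\mathbb{R}^N$ is the linear map $(R_\sigma v)(i,j)=v(\sigma(i),\sigma(j))$ for $i<j$; dualization is $v\mapsto -v$. (The polytope $\widetilde{\operatorname{LO}}_n$ is the image of the linear ordering polytope under $v\mapsto 2v-\mathbf 1$, where the linear ordering polytope is the convex hull of the $0/1$ incidence vectors, indexed by pairs $i<j$, of linear orders on $\{1,\dots,n\}$.) A Euclidean automorphism of a polytope $P\subset\mathbb{R}^N$ is a distance-preserving bijection of $\mathbb{R}^N$ mapping $P$ onto $P$. -}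

module Defs where

open import Level using (Level; suc; zero)
open import Data.Nat using (ℕ)
open import Data.Fin using (Fin) renaming (_<_ to _<F_)
open import Data.Fin.Properties using (_<?_)
open import Data.Fin.Permutation using (Permutation′; _⟨$⟩ʳ_)
open import Data.List using (List; []; _∷_; concatMap; allFin; foldr; map)
open import Data.List.Relation.Unary.All using (All)
open import Data.Product using (Σ; Σ-syntax; ∃; ∃-syntax; _×_; _,_; proj₁; proj₂)
open import Data.Sum using (_⊎_)
open import Relation.Nullary using (¬_; yes; no)
open import Relation.Binary.PropositionalEquality using (_≡_; _≢_)
open import Algebra.Structures using (IsCommutativeRing)
open import Relation.Binary.Structures using (IsStrictTotalOrder)

-- The real numbers, given axiomatically as a complete ordered field
-- (unique up to isomorphism).  The theorem is quantified over every
-- such structure.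

record CompleteOrderedField : Set₁ where
  infixl 6 _+_
  infixl 7 _*_
  infix 4 _<_
  field
    Carrier : Set
    _+_ _*_ : Carrier → Carrier → Carrier
    -_      : Carrier → Carrier
    0# 1#   : Carrier
    _<_     : Carrier → Carrier → Set
    isCommutativeRing : IsCommutativeRing _≡_ _+_ _*_ -_ 0# 1#
    inverse  : ∀ x → x ≢ 0# → ∃[ y ] (x * y ≡ 1#)
    isStrictTotalOrder : IsStrictTotalOrder _≡_ _<_
    0<1      : 0# < 1#
    +-mono-< : ∀ {x y} z → x < y → x + z < y + z
    *-pos    : ∀ {x y} → 0# < x → 0# < y → 0# < x * y
    complete : (S : Carrier → Set) → (∃[ x ] S x) →
               (∃[ b ] (∀ x → S x → ¬ (b < x))) →
               ∃[ s ] ((∀ x → S x → ¬ (s < x)) ×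
                       (∀ b → (∀ x → S x → ¬ (b < x)) → ¬ (b < s)))

  _≤_ : Carrier → Carrier → Set
  x ≤ y = x < y ⊎ x ≡ y

  sum : List Carrier → Carrier
  sum = foldr _+_ 0#

module _ (n : ℕ) where
  -- index set of ℝ^N, N = n choose 2: pairs i < j
  Pair : Set
  Pair = Σ[ i ∈ Fin n ] Σ[ j ∈ Fin n ] (i <F j)

  allPairs : List Pair
  allPairs = concatMap (λ i → concatMap (λ j → pick i j) (allFin n)) (allFin n)
    where
    pick : (i j : Fin n) → List Pair
    pick i j with i <? j
    ... | yes p = (i , j , p) ∷ []
    ... | no _  = []

module _ (ℝ : CompleteOrderedField) (n : ℕ) where
  open CompleteOrderedField ℝ renaming (Carrier to R; _<_ to _<R_)

  Vec : Set
  Vec = Pair n → R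

  _≈V_ : Vec → Vec → Set
  x ≈V y = ∀ p → x p ≡ y p

  dist² : Vec → Vec → R
  dist² x y = sum (map (λ p → (x p + - y p) * (x p + - y p)) (allPairs n))

  -- distance-preserving (‖x-y‖ = ‖f x - f y‖, equivalently squared distances agree)
  Isometry : (Vec → Vec) → Set
  Isometry f = ∀ x y → dist² (f x) (f y) ≡ dist² x y

  Bijective : (Vec → Vec) → Set
  Bijective f = (∀ x y → f x ≈V f y → x ≈V y) × (∀ y → ∃[ x ] (f x ≈V y))

  vπ : Permutation′ n → Vec
  vπ π (i , j , _) with (π ⟨$⟩ʳ j) <? (π ⟨$⟩ʳ i)
  ... | yes _ = 1#
  ... | no _  = - 1#

  InLO : Vec → Set
  InLO x = ∃[ L ] (All (λ c → 0# ≤ proj₂ c) L ×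
                   sum (map proj₂ L) ≡ 1# ×
                   (∀ p → x p ≡ sum (map (λ c → proj₂ c * vπ (proj₁ c) p) L)))
    where L : Set
          L = List (Permutation′ n × R)

  EuclideanAut : (Vec → Vec) → Set
  EuclideanAut f = Isometry f × Bijective f ×
                   (∀ x → InLO x → InLO (f x)) ×
                   (∀ y → InLO y → ∃[ x ] (InLO x × f x ≈V y))

  -- extension v(j,i) = - v(i,j)  (diagonal value irrelevant, set to 0)
  ext : Vec → Fin n → Fin n → R
  ext v i j with i <? j | j <? i
  ... | yes p | _     = v (i , j , p)
  ... | no _  | yes q = - v (j , i , q)
  ... | no _  | no _  = 0#

  Relabel : Permutation′ n → Vec → Vec
  Relabel σ v (i , j , _) = ext v (σ ⟨$⟩ʳ i) (σ ⟨$⟩ʳ j)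

  data Sign : Set where
    plus minus : Sign

  signed : Sign → Vec → Vec
  signed plus  v = v
  signed minus v p = - v p

  signedRelabel : Sign → Permutation′ n → Vec → Vec
  signedRelabel s σ v = signed s (Relabel σ v)

module _ {ℝ : CompleteOrderedField} {n : ℕ} where
  _·ₛ_ : Sign ℝ n → Sign ℝ n → Sign ℝ n
  plus  ·ₛ s = s
  minus ·ₛ plus = minus
  minus ·ₛ minus = plus

{-# OPTIONS --safe #-}

-- An automorphism f permutes the vertices, because these are the points of the polytope that have a
-- partner at the maximal squared distance 4N.  Two vertices at squared distance 4 differ in a single
-- coordinate q, and the difference of the squared distances from x to them is ± 4 x(q); since f
-- preserves distances and every coordinate q arises in this way, each coordinate of f x is ± a
-- coordinate of x, i.e. (f x)(i,j) = x(k,l) for an arc (k,l) depending only on (i,j).  This map of arcs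
-- sends directed 3-cycles to directed 3-cycles, because three arcs can be made forward by a linear
-- order unless they contain a directed cycle.  It therefore acts on each triangle as a relabeling or
-- as a relabeling followed by reversal; the choice agrees on triangles sharing an edge, hence is
-- global, and the relabelings of the triangles fit together to one permutation.

module Submission where

open import Defs
open import Algebra.Bundles using (CommutativeRing)
open import Algebra.Structures using (IsCommutativeRing)
open import Algebra.Solver.Ring.AlmostCommutativeRing using (fromCommutativeRing; _-Raw-AlmostCommutative⟶_)
import Algebra.Solver.Ring
import Algebra.Properties.Ring
import Algebra.Properties.Semiring.Mult.TCOptimised
open import Data.Empty using (⊥-elim)
open import Data.Fin using (Fin; zero; suc; punchIn; punchOut; opposite) renaming (_<_ to _<F_)
open import Data.Fin.Permutation using (Permutation′; permutation; _⟨$⟩ʳ_; _⟨$⟩ˡ_; _∘ₚ_; inverseˡ; inverseʳ; reverse; insert; remove; insert-punchIn; punchIn-permute) renaming (id to idₚ; flip to flipₚ)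
open import Data.Fin.Properties using (_<?_; <-irrelevant; <-cmp; any?; opposite-prop; toℕ<n; punchOut-injective; injective⇒≤; punchIn-mono-≤; punchIn-punchOut)
import Data.Fin.Properties as Fin
open import Data.Integer as ℤ using (ℤ; -[1+_]; _⊖_) renaming (+_ to +ℤ_)
import Data.Integer.Properties as ℤ
open import Data.List using (List; []; _∷_; map; concatMap; allFin)
open import Data.List.Membership.Propositional using (_∈_)
open import Data.List.Membership.Propositional.Properties using (∈-concatMap⁺; ∈-concatMap⁻; ∈-allFin; ∈-map⁺)
open import Data.List.Membership.Propositional.Properties.WithK using (unique∧set⇒bag)
open import Data.List.Properties using (map-∘)
open import Data.List.Relation.Binary.BagAndSetEquality using (∼bag⇒↭)
open import Data.List.Relation.Binary.Permutation.Propositional as ↭ using (_↭_)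
open import Data.List.Relation.Unary.All as All using (All; []; _∷_)
import Data.List.Relation.Unary.All.Properties as All
open import Data.List.Relation.Unary.AllPairs as AllPairs using ([]; _∷_)
import Data.List.Relation.Unary.AllPairs.Properties as AllPairs
open import Data.List.Relation.Unary.Any as Any using (here; there)
open import Data.List.Relation.Unary.Unique.Propositional using (Unique)
import Data.List.Relation.Unary.Unique.Propositional.Properties as Unique
open import Data.Maybe using (Maybe; just; nothing)
open import Data.Nat as ℕ using (ℕ; zero; suc; s≤s; s<s; z<s)
import Data.Nat.Properties as ℕ
open import Data.Product using (Σ-syntax; ∃-syntax; _×_; _,_; proj₁; proj₂; swap; map₂)
open import Data.Sum as Sum using (_⊎_; inj₁; inj₂; [_,_]′)
open import Function using (_∘_; mk⇔)
open import Function.Definitions using (Injective)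
open import Relation.Binary using (tri<; tri≈; tri>)
open import Relation.Binary.PropositionalEquality using (_≡_; _≢_; refl; sym; trans; cong; cong₂; subst; subst₂; module ≡-Reasoning)
open import Relation.Binary.Structures using (IsStrictTotalOrder)
open import Relation.Nullary using (¬_; yes; no; contradiction)

-- Permutations and order reversal

permutation-injective : ∀ {n} (π : Permutation′ n) {i j} → π ⟨$⟩ʳ i ≡ π ⟨$⟩ʳ j → i ≡ j
permutation-injective π eq = trans (sym (inverseˡ π)) (trans (cong (π ⟨$⟩ˡ_) eq) (inverseˡ π))

opposite-< : ∀ {n} {i j : Fin n} → i <F j → opposite j <F opposite i
opposite-< {n} {i} {j} i<j rewrite opposite-prop i | opposite-prop j =
  ℕ.∸-monoʳ-< (s≤s i<j) (toℕ<n j)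

-- Linear orders extending a set of arcs

-- Pigeonhole: if `f` missed a value, composing it with `punchOut` would inject `Fin (suc n)` into
-- `Fin n`.
injective⇒permutation : ∀ {n} (f : Fin n → Fin n) → Injective _≡_ _≡_ f →
  ∃[ π ] (∀ i → π ⟨$⟩ʳ i ≡ f i)
injective⇒permutation {n} f inj =
  permutation f (λ y → proj₁ (surj y)) (λ y → proj₂ (surj y)) (λ x → inj (proj₂ (surj (f x)))) , λ _ → refl
  where
  missed : ∀ {n} (f : Fin n → Fin n) → Injective _≡_ _≡_ f → ∀ y → ¬ (∀ x → y ≢ f x)
  missed {suc n} f inj y y≢f = ℕ.1+n≰n (injective⇒≤ {f = λ x → punchOut (y≢f x)}
    (λ {x} {x′} eq → inj (punchOut-injective (y≢f x) (y≢f x′) eq)))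
  surj : ∀ y → ∃[ x ] (f x ≡ y)
  surj y with any? (λ x → f x Fin.≟ y)
  ... | yes p = p
  ... | no ¬p = ⊥-elim (missed f inj y (λ x y≡fx → ¬p (x , sym y≡fx)))

-- Removing `b` from `π` and reinserting it with value `zero` leaves the comparisons of the other
-- elements intact, because `punchIn` is monotone.
lowered : ∀ {n} (π : Permutation′ n) (b : Fin n) → Σ[ ρ ∈ Permutation′ n ]
  ((∀ k → k ≢ b → ρ ⟨$⟩ʳ b <F ρ ⟨$⟩ʳ k) ×
   (∀ k l → k ≢ b → l ≢ b → π ⟨$⟩ʳ k <F π ⟨$⟩ʳ l → ρ ⟨$⟩ʳ k <F ρ ⟨$⟩ʳ l))
lowered {suc n} π b = ρ , bottom , preserves
  where
  ρ = insert b zero (remove b π)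
  ρb : ρ ⟨$⟩ʳ b ≡ zero
  ρb with b Fin.≟ b
  ... | yes _ = refl
  ... | no b≢b = contradiction refl b≢b
  ρ-punchIn : ∀ {k} (k≢b : k ≢ b) → ρ ⟨$⟩ʳ k ≡ suc (remove b π ⟨$⟩ʳ punchOut (k≢b ∘ sym))
  ρ-punchIn k≢b = trans (cong (ρ ⟨$⟩ʳ_) (sym (punchIn-punchOut (k≢b ∘ sym)))) (insert-punchIn b zero (remove b π) _)
  π-punchIn : ∀ {k} (k≢b : k ≢ b) → π ⟨$⟩ʳ k ≡ punchIn (π ⟨$⟩ʳ b) (remove b π ⟨$⟩ʳ punchOut (k≢b ∘ sym))
  π-punchIn k≢b = trans (cong (π ⟨$⟩ʳ_) (sym (punchIn-punchOut (k≢b ∘ sym)))) (punchIn-permute π b _)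
  bottom : ∀ k → k ≢ b → ρ ⟨$⟩ʳ b <F ρ ⟨$⟩ʳ k
  bottom k k≢b rewrite ρb | ρ-punchIn k≢b = z<s
  preserves : ∀ k l → k ≢ b → l ≢ b → π ⟨$⟩ʳ k <F π ⟨$⟩ʳ l → ρ ⟨$⟩ʳ k <F ρ ⟨$⟩ʳ l
  preserves k l k≢b l≢b k<l rewrite ρ-punchIn k≢b | ρ-punchIn l≢b | π-punchIn k≢b | π-punchIn l≢b =
    s<s (ℕ.≰⇒> (λ l≤k → ℕ.<⇒≱ k<l (punchIn-mono-≤ (π ⟨$⟩ʳ b) _ _ l≤k)))

-- An arc `(i , j)` is forward when `i` is ranked above `j`; this is the convention under which a
-- vertex has coordinate `1#` at `(i , j)`.
Orderable : ∀ {n} → List (Fin n × Fin n) → Set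
Orderable {n} arcs = Σ[ π ∈ Permutation′ n ] All (λ (i , j) → π ⟨$⟩ʳ j <F π ⟨$⟩ʳ i) arcs

module _ {n : ℕ} where
  -- A vertex at which no arc starts can be placed at the bottom of the order.
  orderable-∷ : ∀ {a b : Fin n} {arcs} → a ≢ b → All (λ (i , _) → i ≢ b) arcs →
    Orderable arcs → Orderable ((a , b) ∷ arcs)
  orderable-∷ {a} {b} a≢b starts (π , ordered) =
    let (ρ , bottom , preserves) = lowered π b
    in ρ , bottom a a≢b ∷ All.map (λ { {i , j} (i≢b , lt) → helper ρ bottom preserves i j i≢b lt })
                            (All.zip (starts , ordered))
    where
    helper : ∀ (ρ : Permutation′ n) → (∀ k → k ≢ b → ρ ⟨$⟩ʳ b <F ρ ⟨$⟩ʳ k) →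
      (∀ k l → k ≢ b → l ≢ b → π ⟨$⟩ʳ k <F π ⟨$⟩ʳ l → ρ ⟨$⟩ʳ k <F ρ ⟨$⟩ʳ l) →
      ∀ i j → i ≢ b → π ⟨$⟩ʳ j <F π ⟨$⟩ʳ i → ρ ⟨$⟩ʳ j <F ρ ⟨$⟩ʳ i
    helper ρ bottom preserves i j i≢b lt with j Fin.≟ b
    ... | yes refl = bottom i i≢b
    ... | no j≢b = preserves j i j≢b i≢b lt

  orderable-swap : ∀ {p q : Fin n × Fin n} {arcs} → Orderable (p ∷ q ∷ arcs) → Orderable (q ∷ p ∷ arcs)
  orderable-swap (π , p ∷ q ∷ r) = π , q ∷ p ∷ r

  Antiparallel : Fin n × Fin n → Fin n × Fin n → Set
  Antiparallel (i , j) (k , l) = j ≡ k × l ≡ i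

  -- Unless each arc starts where the other ends, one of the two ends is the start of neither arc
  -- and can go to the bottom.
  orderable₂ : ∀ {a b c d : Fin n} → a ≢ b → c ≢ d → ¬ Antiparallel (a , b) (c , d) →
    Orderable ((a , b) ∷ (c , d) ∷ [])
  orderable₂ {a} {b} {c} {d} a≢b c≢d ¬anti with c Fin.≟ b | a Fin.≟ d
  ... | no c≢b | _ = orderable-∷ a≢b (c≢b ∷ []) (orderable-∷ c≢d [] (idₚ , []))
  ... | _ | no a≢d = orderable-swap (orderable-∷ c≢d (a≢d ∷ []) (orderable-∷ a≢b [] (idₚ , [])))
  ... | yes c≡b | yes a≡d = ⊥-elim (¬anti (sym c≡b , sym a≡d))

  Cycle₃ : (p q r : Fin n × Fin n) → Set
  Cycle₃ (a , b) (c , d) (e , f) = b ≡ c × d ≡ e × f ≡ a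

  -- If the end of some arc is the start of neither other arc, it goes to the bottom and
  -- `orderable₂` handles the rest. Otherwise every arc is followed by another one, and without
  -- antiparallel pairs only the two cyclic arrangements remain.
  orderable₃ : ∀ {a b c d e f : Fin n} → a ≢ b → c ≢ d → e ≢ f →
    ¬ Antiparallel (a , b) (c , d) → ¬ Antiparallel (c , d) (e , f) → ¬ Antiparallel (e , f) (a , b) →
    Orderable ((a , b) ∷ (c , d) ∷ (e , f) ∷ []) ⊎
    Cycle₃ (a , b) (c , d) (e , f) ⊎ Cycle₃ (a , b) (e , f) (c , d)
  orderable₃ {a} {b} {c} {d} {e} {f} a≢b c≢d e≢f ¬pq ¬qr ¬rp
    with c Fin.≟ b | e Fin.≟ b | a Fin.≟ d | e Fin.≟ d | a Fin.≟ f | c Fin.≟ f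
  ... | no c≢b | no e≢b | _ | _ | _ | _ = inj₁ (orderable-∷ a≢b (c≢b ∷ e≢b ∷ []) (orderable₂ c≢d e≢f ¬qr))
  ... | _ | _ | no a≢d | no e≢d | _ | _ = inj₁ (orderable-swap (orderable-∷ c≢d (a≢d ∷ e≢d ∷ [])
          (orderable₂ a≢b e≢f (λ (x , y) → ¬rp (y , x)))))
  ... | _ | _ | _ | _ | no a≢f | no c≢f = inj₁ (rotate (orderable-∷ e≢f (a≢f ∷ c≢f ∷ []) (orderable₂ a≢b c≢d ¬pq)))
    where
    rotate : ∀ {p q r : Fin n × Fin n} → Orderable (r ∷ p ∷ q ∷ []) → Orderable (p ∷ q ∷ r ∷ [])
    rotate (π , r ∷ p ∷ q ∷ []) = π , p ∷ q ∷ r ∷ []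
  ... | yes c≡b | _ | yes a≡d | _ | _ | _ = ⊥-elim (¬pq (sym c≡b , sym a≡d))
  ... | yes c≡b | _ | _ | yes e≡d | yes a≡f | _ = inj₂ (inj₁ (sym c≡b , sym e≡d , sym a≡f))
  ... | _ | _ | _ | yes e≡d | _ | yes c≡f = ⊥-elim (¬qr (sym e≡d , sym c≡f))
  ... | _ | yes e≡b | _ | _ | yes a≡f | _ = ⊥-elim (¬rp (sym a≡f , sym e≡b))
  ... | _ | yes e≡b | yes a≡d | _ | _ | yes c≡f = inj₂ (inj₂ (sym e≡b , sym c≡f , sym a≡d))

-- Maps of arcs that preserve directed triangles

avoid : ∀ {m} (a b : Fin (suc (suc (suc m)))) → ∃[ c ] (c ≢ a × c ≢ b)
avoid zero zero = suc zero , (λ ()) , (λ ())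
avoid zero (suc zero) = suc (suc zero) , (λ ()) , (λ ())
avoid zero (suc (suc b)) = suc zero , (λ ()) , (λ ())
avoid (suc zero) zero = suc (suc zero) , (λ ()) , (λ ())
avoid (suc (suc a)) zero = suc zero , (λ ()) , (λ ())
avoid (suc a) (suc b) = zero , (λ ()) , (λ ())

-- `T a b k l` is read as: the arc `(a , b)` is sent to the arc `(k , l)`. The assumptions are
-- symmetric under reversing all images, so the module applies to `T` and to its reversal alike.
module ArcMap {m : ℕ} (T : (a b k l : Fin (suc (suc (suc m)))) → Set)
  (rev : ∀ {a b k l} → T a b k l → T b a l k)
  (functional : ∀ {a b k l k′ l′} → a ≢ b → T a b k l → T a b k′ l′ → k ≡ k′ × l ≡ l′)
  (nondegenerate : ∀ {a b k} → a ≢ b → ¬ T a b k k)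
  where

  private
    n : ℕ
    n = suc (suc (suc m))

  -- In both cases `a`, `b`, `c` correspond to `x`, `y`, `z`; in the negative case every image arc
  -- is reversed in addition.
  Positive Negative : Fin n → Fin n → Fin n → Set
  Positive a b c = ∃[ x ] ∃[ y ] ∃[ z ] (T a b x y × T b c y z × T c a z x)
  Negative a b c = ∃[ x ] ∃[ y ] ∃[ z ] (T a b y x × T b c z y × T c a x z)

  module _ (triangle : ∀ {a b c} → a ≢ b → b ≢ c → c ≢ a → Positive a b c ⊎ Negative a b c) where

    rotated : ∀ {a b c} → Positive a b c → Positive b c a
    rotated (x , y , z , ab , bc , ca) = y , z , x , bc , ca , ab

    mirrored : ∀ {a b c} → Positive a b c → Positive b a c
    mirrored (x , y , z , ab , bc , ca) = y , x , z , rev ab , rev ca , rev bc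

    -- Two triangles on a common edge have the same sign: otherwise the images of (c , b) and (b , d)
    -- would have no common vertex, although they lie in a common triangle.
    same-sign : ∀ {a b c d} → a ≢ b → b ≢ c → c ≢ a → b ≢ d → d ≢ a → Positive a b c → Positive a b d
    same-sign {a} {b} {c} {d} a≢b b≢c c≢a b≢d d≢a pos@(x , y , z , ab , bc , ca) with c Fin.≟ d
    ... | yes refl = pos
    ... | no c≢d with triangle a≢b b≢d d≢a
    ...   | inj₁ pos′ = pos′
    ...   | inj₂ (x′ , y′ , w , ab′ , bd , da) with functional a≢b ab ab′
    ...     | refl , refl with triangle (b≢c ∘ sym) b≢d (c≢d ∘ sym)
    ...       | inj₁ (_ , _ , _ , cb , bd′ , _)
                with refl , refl ← functional (b≢c ∘ sym) (rev bc) cb | refl , refl ← functional b≢d bd bd′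
                = ⊥-elim (nondegenerate d≢a da)
    ...       | inj₂ (_ , _ , _ , cb , bd′ , _)
                with refl , refl ← functional (b≢c ∘ sym) (rev bc) cb | refl , refl ← functional b≢d bd bd′
                = ⊥-elim (nondegenerate c≢a ca)

    PositiveEdge : Fin n → Fin n → Set
    PositiveEdge a b = ∀ c → b ≢ c → c ≢ a → Positive a b c

    positive-edge : ∀ {a b c} → a ≢ b → b ≢ c → c ≢ a → Positive a b c → PositiveEdge a b
    positive-edge a≢b b≢c c≢a pos d b≢d d≢a = same-sign a≢b b≢c c≢a b≢d d≢a pos

    positive-flip : ∀ {a b} → PositiveEdge a b → PositiveEdge b a
    positive-flip edge c a≢c c≢b = mirrored (edge c (c≢b ∘ sym) (a≢c ∘ sym))

    -- The triangle on `a`, `b`, `c` contains both edges and carries the sign from one to the other.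
    positive-turn : ∀ {a b c} → a ≢ b → a ≢ c → PositiveEdge a b → PositiveEdge a c
    positive-turn {a} {b} {c} a≢b a≢c edge with b Fin.≟ c
    ... | yes refl = edge
    ... | no b≢c = positive-flip (positive-edge (a≢c ∘ sym) a≢b b≢c (rotated (rotated (edge c b≢c (a≢c ∘ sym)))))

    -- The sign travels from the given edge at `a` to the edge joining `a` and `c`, and then turns
    -- about `c`.
    positive-everywhere : ∀ {a b} → a ≢ b → PositiveEdge a b → ∀ {c d} → c ≢ d → PositiveEdge c d
    positive-everywhere {a} a≢b edge {c} {d} c≢d with a Fin.≟ c
    ... | yes refl = positive-turn a≢b c≢d edge
    ... | no a≢c = positive-turn (a≢c ∘ sym) c≢d (positive-flip (positive-turn a≢b a≢c edge))

    -- Once every triangle is positive, the images of all arcs leaving `i` start at one common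
    -- vertex, which is taken as the value of the permutation at `i`.
    positive⇒permutation : ∀ {a b c} → a ≢ b → b ≢ c → c ≢ a → Positive a b c →
      ∃[ σ ] (∀ {i j} → i ≢ j → T i j (σ ⟨$⟩ʳ i) (σ ⟨$⟩ʳ j))
    positive⇒permutation a≢b b≢c c≢a pos = σ , λ {i} {j} i≢j →
      subst₂ (T i j) (sym (σ≗image i)) (sym (σ≗image j)) (T-image i≢j)
      where
      edges : ∀ {i j} → i ≢ j → PositiveEdge i j
      edges = positive-everywhere a≢b (positive-edge a≢b b≢c c≢a pos)
      -- The common vertex is read off from the arc to an arbitrary `k`; the third vertex `l`
      -- supplies a positive triangle on that arc.
      base : (i : Fin n) → ∃[ x ] ∃[ k ] (i ≢ k × ∃[ y ] T i k x y)
      base i =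
        let (k , k≢i , _) = avoid i i
            (l , l≢i , l≢k) = avoid i k
            (x , y , _ , ik , _) = edges (k≢i ∘ sym) l (l≢k ∘ sym) l≢i
        in x , k , k≢i ∘ sym , y , ik
      image : Fin n → Fin n
      image i = proj₁ (base i)
      turn : ∀ {i j x} → i ≢ j → ∃[ k ] (i ≢ k × ∃[ y ] T i k x y) → ∃[ y ] T i j x y
      turn {i} {j} i≢j (k , i≢k , y , ik) with j Fin.≟ k
      ... | yes refl = y , ik
      ... | no j≢k with edges i≢k j (j≢k ∘ sym) (i≢j ∘ sym)
      ...   | _ , _ , z , ik′ , _ , ji with refl , refl ← functional i≢k ik ik′ = z , rev ji
      star : ∀ {i j} → i ≢ j → ∃[ y ] T i j (image i) y
      star {i} i≢j = turn i≢j (proj₂ (base i))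
      -- The image of `(i , j)` starts at `image i`, and that of `(j , i)` at `image j`; by reversal
      -- the latter is the end of the former.
      T-image : ∀ {i j} → i ≢ j → T i j (image i) (image j)
      T-image i≢j with star i≢j | star (i≢j ∘ sym)
      ... | y , ij | x , ji with refl , refl ← functional i≢j ij (rev ji) = ij
      image-injective : Injective _≡_ _≡_ image
      image-injective {i} {j} eq with i Fin.≟ j
      ... | yes i≡j = i≡j
      ... | no i≢j = ⊥-elim (nondegenerate i≢j (subst (T i j (image i)) (sym eq) (T-image i≢j)))
      σ = proj₁ (injective⇒permutation image image-injective)
      σ≗image : ∀ i → σ ⟨$⟩ʳ i ≡ image i
      σ≗image = proj₂ (injective⇒permutation image image-injective)

module _ {m : ℕ} (T : (a b k l : Fin (suc (suc (suc m)))) → Set)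
  (rev : ∀ {a b k l} → T a b k l → T b a l k)
  (functional : ∀ {a b k l k′ l′} → a ≢ b → T a b k l → T a b k′ l′ → k ≡ k′ × l ≡ l′)
  (nondegenerate : ∀ {a b k} → a ≢ b → ¬ T a b k k)
  where
  private
    module P = ArcMap T rev functional nondegenerate
    module N = ArcMap (λ a b k l → T a b l k) rev (λ a≢b t t′ → swap (functional a≢b t t′)) nondegenerate

  -- The sign of one triangle decides between the alternatives. A negative triangle becomes positive
  -- when all images are reversed, so the same argument runs in `N`.
  triangles⇒relabeling : (∀ {a b c} → a ≢ b → b ≢ c → c ≢ a → P.Positive a b c ⊎ P.Negative a b c) →
    ∃[ σ ] ((∀ {i j} → i ≢ j → T i j (σ ⟨$⟩ʳ i) (σ ⟨$⟩ʳ j)) ⊎ (∀ {i j} → i ≢ j → T i j (σ ⟨$⟩ʳ j) (σ ⟨$⟩ʳ i)))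
  triangles⇒relabeling triangle with triangle {zero} {suc zero} {suc (suc zero)} (λ ()) (λ ()) (λ ())
  ... | inj₁ pos = map₂ inj₁ (P.positive⇒permutation triangle (λ ()) (λ ()) (λ ()) pos)
  ... | inj₂ neg = map₂ inj₂ (N.positive⇒permutation (λ p q r → Sum.swap (triangle p q r)) (λ ()) (λ ()) (λ ()) neg)

-- Orders in which two chosen elements are lowest

lowered₂ : ∀ {n} {a b : Fin n} → a ≢ b → Σ[ π ∈ Permutation′ n ]
  (π ⟨$⟩ʳ b <F π ⟨$⟩ʳ a ×
   (∀ {k l} → k ≡ a ⊎ k ≡ b → l ≢ a → l ≢ b → π ⟨$⟩ʳ k <F π ⟨$⟩ʳ l) ×
   (∀ {k l} → k ≢ a → k ≢ b → l ≢ a → l ≢ b → k <F l → π ⟨$⟩ʳ k <F π ⟨$⟩ʳ l))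
lowered₂ {a = a} {b} a≢b =
  -- Starting from `idₚ` keeps the remaining elements in their natural order, so exchanging `a` and
  -- `b` changes a single comparison.
  let (ρ , ρ-bottom , ρ-mono) = lowered idₚ a
      (π , π-bottom , π-mono) = lowered ρ b
  in π , π-bottom a a≢b ,
     (λ { (inj₁ refl) l≢a l≢b → π-mono _ _ a≢b l≢b (ρ-bottom _ l≢a)
        ; (inj₂ refl) l≢a l≢b → π-bottom _ l≢b }) ,
     (λ k≢a k≢b l≢a l≢b k<l → π-mono _ _ k≢b l≢b (ρ-mono _ _ k≢a l≢a k<l))

among? : ∀ {n} (a b k : Fin n) → (k ≡ a ⊎ k ≡ b) ⊎ (k ≢ a × k ≢ b)
among? a b k with k Fin.≟ a | k Fin.≟ b
... | yes k≡a | _ = inj₁ (inj₁ k≡a)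
... | no _ | yes k≡b = inj₁ (inj₂ k≡b)
... | no k≢a | no k≢b = inj₂ (k≢a , k≢b)

-- The index set of the coordinates

-- `key` recovers the block in which an element lies, so distinct blocks are disjoint.
concatMap-unique : ∀ {A B : Set} (key : B → A) {f : A → List B} {as} → Unique as →
  (∀ a → Unique (f a)) → (∀ a {b} → b ∈ f a → key b ≡ a) → Unique (concatMap f as)
concatMap-unique key as! f! key-f = Unique.concat⁺ (All.map⁺ (All.universal f! _))
  (AllPairs.map⁺ (AllPairs.map (λ a≢a′ {b} (b∈ , b∈′) → a≢a′ (trans (sym (key-f _ b∈)) (key-f _ b∈′))) as!))

pair-≡ : ∀ {n} {i j i′ j′ : Fin n} {p q} → i ≡ i′ → j ≡ j′ → _≡_ {A = Pair n} (i , j , p) (i′ , j′ , q)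
pair-≡ {i = i} {j} {p = p} {q} refl refl = cong (λ r → i , j , r) (<-irrelevant p q)

module _ {n : ℕ} where

  private
    -- The enumerating function is local to allPairs; unification recovers it.
    enumeration : Σ[ pick ∈ (Fin n → Fin n → List (Pair n)) ]
      concatMap (λ i → concatMap (λ j → pick i j) (allFin n)) (allFin n) ≡ allPairs n
    enumeration = _ , refl

    pick = proj₁ enumeration

    pick-∈ : ∀ {i j} (p : i <F j) → (i , j , p) ∈ pick i j
    pick-∈ {i} {j} p with i <? j
    ... | yes _ = here (pair-≡ refl refl)
    ... | no i≮j = contradiction p i≮j

    pick-unique : ∀ i j → Unique (pick i j)
    pick-unique i j with i <? j
    ... | yes _ = [] ∷ []
    ... | no _ = []

    pick-key : ∀ i j {p} → p ∈ pick i j → proj₁ p ≡ i × proj₁ (proj₂ p) ≡ j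
    pick-key i j p∈ with i <? j
    pick-key i j (here refl) | yes _ = refl , refl
    pick-key i j () | no _

  allPairs-complete : ∀ p → p ∈ allPairs n
  allPairs-complete (i , j , p) = ∈-concatMap⁺ _ (Any.map (λ { refl →
    ∈-concatMap⁺ _ (Any.map (λ { refl → pick-∈ p }) (∈-allFin j)) }) (∈-allFin i))

  allPairs-unique : Unique (allPairs n)
  allPairs-unique = concatMap-unique proj₁ (Unique.allFin⁺ n)
    (λ i → concatMap-unique (λ p → proj₁ (proj₂ p)) (Unique.allFin⁺ n) (pick-unique i)
      (λ j p∈ → proj₂ (pick-key i j p∈)))
    (λ i p∈ → let (j , p∈′) = Any.satisfied (∈-concatMap⁻ (pick i) {xs = allFin n} p∈) in proj₁ (pick-key i j p∈′))

-- Action of permutations on pairs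

permutePair : ∀ {n} → Permutation′ n → Pair n → Pair n
permutePair π (i , j , i<j) with <-cmp (π ⟨$⟩ʳ i) (π ⟨$⟩ʳ j)
... | tri< p _ _ = π ⟨$⟩ʳ i , π ⟨$⟩ʳ j , p
... | tri≈ _ eq _ = contradiction (permutation-injective π eq) (Fin.<⇒≢ i<j)
... | tri> _ _ p = π ⟨$⟩ʳ j , π ⟨$⟩ʳ i , p

Ends : ∀ {n} → Pair n → Fin n → Fin n → Set
Ends (k , l , _) i j = (k ≡ i × l ≡ j) ⊎ (k ≡ j × l ≡ i)

permutePair-ends : ∀ {n} (π : Permutation′ n) p →
  Ends (permutePair π p) (π ⟨$⟩ʳ proj₁ p) (π ⟨$⟩ʳ proj₁ (proj₂ p))
permutePair-ends π (i , j , i<j) with <-cmp (π ⟨$⟩ʳ i) (π ⟨$⟩ʳ j)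
... | tri< p _ _ = inj₁ (refl , refl)
... | tri≈ _ eq _ = contradiction (permutation-injective π eq) (Fin.<⇒≢ i<j)
... | tri> _ _ p = inj₂ (refl , refl)

ends-unique : ∀ {n} (p q : Pair n) → Ends q (proj₁ p) (proj₁ (proj₂ p)) → q ≡ p
ends-unique p q (inj₁ (eq₁ , eq₂)) = pair-≡ eq₁ eq₂
ends-unique (i , j , i<j) (.j , .i , j<i) (inj₂ (refl , refl)) = contradiction j<i (ℕ.<-asym i<j)

-- An increasing pair is determined by its unordered ends, so it suffices to follow the ends through
-- both permutations.
permutePair-inverse : ∀ {n} (π ρ : Permutation′ n) → (∀ i → ρ ⟨$⟩ʳ (π ⟨$⟩ʳ i) ≡ i) →
  ∀ p → permutePair ρ (permutePair π p) ≡ p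
permutePair-inverse π ρ inv p = ends-unique p _
  (compose {permutePair ρ (permutePair π p)} (permutePair π p)
    (permutePair-ends π p) (permutePair-ends ρ (permutePair π p)))
  where
  compose : ∀ {q} r → Ends r (π ⟨$⟩ʳ proj₁ p) (π ⟨$⟩ʳ proj₁ (proj₂ p)) →
    Ends q (ρ ⟨$⟩ʳ proj₁ r) (ρ ⟨$⟩ʳ proj₁ (proj₂ r)) → Ends q (proj₁ p) (proj₁ (proj₂ p))
  compose (k , l , _) (inj₁ (refl , refl)) (inj₁ (e₁ , e₂)) = inj₁ (trans e₁ (inv _) , trans e₂ (inv _))
  compose (k , l , _) (inj₁ (refl , refl)) (inj₂ (e₁ , e₂)) = inj₂ (trans e₁ (inv _) , trans e₂ (inv _))
  compose (k , l , _) (inj₂ (refl , refl)) (inj₁ (e₁ , e₂)) = inj₂ (trans e₁ (inv _) , trans e₂ (inv _))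
  compose (k , l , _) (inj₂ (refl , refl)) (inj₂ (e₁ , e₂)) = inj₁ (trans e₁ (inv _) , trans e₂ (inv _))

-- Both lists are free of repetitions and contain every pair, hence agree as bags.
allPairs-permuted : ∀ {n} (π : Permutation′ n) → map (permutePair π) (allPairs n) ↭ allPairs n
allPairs-permuted {n} π = ∼bag⇒↭ (unique∧set⇒bag (Unique.map⁺ injective allPairs-unique) allPairs-unique
  (λ {p} → mk⇔ (λ _ → allPairs-complete p) (λ _ → subst (_∈ map (permutePair π) (allPairs n))
    (permutePair-inverse (flipₚ π) π (λ _ → inverseʳ π) p) (∈-map⁺ (permutePair π) (allPairs-complete _)))))
  where
  injective : ∀ {p q} → permutePair π p ≡ permutePair π q → p ≡ q
  injective {p} {q} eq = trans (sym (permutePair-inverse π (flipₚ π) (λ _ → inverseˡ π) p))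
    (trans (cong (permutePair (flipₚ π)) eq) (permutePair-inverse π (flipₚ π) (λ _ → inverseˡ π) q))

-- Ordered fields and finite sums

-- Coefficients from the integers, which map to every commutative ring, let the ring solver cancel
-- terms without deciding equality in `A`.
module IntegerCoefficients {c ℓ} (A : CommutativeRing c ℓ) where
  open CommutativeRing A renaming (refl to ≈-refl; sym to ≈-sym; trans to ≈-trans)
  open Algebra.Properties.Ring ring using (-0#≈0#; -‿involutive; -‿distribˡ-*; -‿distribʳ-*; -‿+-comm)
  open Algebra.Properties.Semiring.Mult.TCOptimised semiring using (1+×; ×-homo-+; ×1-homo-*) renaming (_×_ to _·_)
  open import Relation.Binary.Reasoning.Setoid setoid

  ⟦_⟧ : ℤ → Carrier
  ⟦ +ℤ n ⟧ = n · 1#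
  ⟦ -[1+ n ] ⟧ = - (suc n · 1#)

  ⟦⊖⟧ : ∀ m n → ⟦ m ⊖ n ⟧ ≈ m · 1# + - (n · 1#)
  ⟦⊖⟧ zero zero = ≈-sym (≈-trans (+-identityˡ _) -0#≈0#)
  ⟦⊖⟧ zero (suc n) = ≈-sym (+-identityˡ _)
  ⟦⊖⟧ (suc m) zero = ≈-sym (≈-trans (+-congˡ -0#≈0#) (+-identityʳ _))
  ⟦⊖⟧ (suc m) (suc n) = begin
    ⟦ suc m ⊖ suc n ⟧                            ≡⟨ cong ⟦_⟧ (ℤ.[1+m]⊖[1+n]≡m⊖n m n) ⟩
    ⟦ m ⊖ n ⟧                                    ≈⟨ ⟦⊖⟧ m n ⟩
    m · 1# + - (n · 1#)                          ≈⟨ +-congʳ (+-identityʳ _) ⟨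
    (m · 1# + 0#) + - (n · 1#)                   ≈⟨ +-congʳ (+-congˡ (-‿inverseʳ 1#)) ⟨
    (m · 1# + (1# + - 1#)) + - (n · 1#)          ≈⟨ +-congʳ (+-assoc _ _ _) ⟨
    ((m · 1# + 1#) + - 1#) + - (n · 1#)          ≈⟨ +-assoc _ _ _ ⟩
    (m · 1# + 1#) + (- 1# + - (n · 1#))          ≈⟨ +-cong (+-comm _ _) (-‿+-comm _ _) ⟩
    (1# + m · 1#) + - (1# + n · 1#)              ≈⟨ +-cong (1+× m 1#) (-‿cong (1+× n 1#)) ⟨
    suc m · 1# + - (suc n · 1#)                  ∎

  ⟦-⟧ : ∀ i → ⟦ ℤ.- i ⟧ ≈ - ⟦ i ⟧
  ⟦-⟧ (+ℤ zero) = ≈-sym -0#≈0#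
  ⟦-⟧ (+ℤ (suc n)) = ≈-refl
  ⟦-⟧ -[1+ n ] = ≈-sym (-‿involutive _)

  ⟦+⟧ : ∀ i j → ⟦ i ℤ.+ j ⟧ ≈ ⟦ i ⟧ + ⟦ j ⟧
  ⟦+⟧ (+ℤ m) (+ℤ n) = ×-homo-+ 1# m n
  ⟦+⟧ (+ℤ m) -[1+ n ] = ⟦⊖⟧ m (suc n)
  ⟦+⟧ -[1+ m ] (+ℤ n) = ≈-trans (⟦⊖⟧ n (suc m)) (+-comm _ _)
  ⟦+⟧ -[1+ m ] -[1+ n ] = begin
    - (suc (suc (m ℕ.+ n)) · 1#)      ≡⟨ cong (λ k → - (suc k · 1#)) (ℕ.+-suc m n) ⟨
    - ((suc m ℕ.+ suc n) · 1#)        ≈⟨ -‿cong (×-homo-+ 1# (suc m) (suc n)) ⟩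
    - (suc m · 1# + suc n · 1#)       ≈⟨ -‿+-comm _ _ ⟨
    - (suc m · 1#) + - (suc n · 1#)   ∎

  ⟦pos*⟧ : ∀ m j → ⟦ +ℤ m ℤ.* j ⟧ ≈ (m · 1#) * ⟦ j ⟧
  ⟦pos*⟧ m (+ℤ n) = ≈-trans (reflexive (cong ⟦_⟧ (sym (ℤ.pos-* m n)))) (×1-homo-* m n)
  ⟦pos*⟧ m -[1+ n ] = begin
    ⟦ +ℤ m ℤ.* -[1+ n ] ⟧            ≡⟨ cong ⟦_⟧ (ℤ.neg-distribʳ-* (+ℤ m) (+ℤ (suc n))) ⟨
    ⟦ ℤ.- (+ℤ m ℤ.* +ℤ (suc n)) ⟧       ≈⟨ ⟦-⟧ (+ℤ m ℤ.* +ℤ (suc n)) ⟩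
    - ⟦ +ℤ m ℤ.* +ℤ (suc n) ⟧           ≈⟨ -‿cong (⟦pos*⟧ m (+ℤ (suc n))) ⟩
    - ((m · 1#) * (suc n · 1#))     ≈⟨ -‿distribʳ-* _ _ ⟩
    (m · 1#) * (- (suc n · 1#))     ∎

  ⟦*⟧ : ∀ i j → ⟦ i ℤ.* j ⟧ ≈ ⟦ i ⟧ * ⟦ j ⟧
  ⟦*⟧ (+ℤ m) j = ⟦pos*⟧ m j
  ⟦*⟧ -[1+ m ] j = begin
    ⟦ -[1+ m ] ℤ.* j ⟧         ≡⟨ cong ⟦_⟧ (ℤ.neg-distribˡ-* (+ℤ (suc m)) j) ⟨
    ⟦ ℤ.- (+ℤ (suc m) ℤ.* j) ⟧    ≈⟨ ⟦-⟧ (+ℤ (suc m) ℤ.* j) ⟩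
    - ⟦ +ℤ (suc m) ℤ.* j ⟧        ≈⟨ -‿cong (⟦pos*⟧ (suc m) j) ⟩
    - ((suc m · 1#) * ⟦ j ⟧)   ≈⟨ -‿distribˡ-* _ _ ⟩
    - (suc m · 1#) * ⟦ j ⟧     ∎

  morphism : ℤ.+-*-rawRing -Raw-AlmostCommutative⟶ fromCommutativeRing A
  morphism = record
    { ⟦_⟧ = ⟦_⟧ ; +-homo = ⟦+⟧ ; *-homo = ⟦*⟧ ; -‿homo = ⟦-⟧
    ; 0-homo = ≈-refl ; 1-homo = ≈-refl }

  weaklyEqual? : ∀ i j → Maybe (⟦ i ⟧ ≈ ⟦ j ⟧)
  weaklyEqual? i j with i ℤ.≟ j
  ... | yes refl = just ≈-refl
  ... | no _ = nothing

  open Algebra.Solver.Ring ℤ.+-*-rawRing (fromCommutativeRing A) morphism weaklyEqual? public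
    using (solve; _:=_; _:+_; _:*_; _:-_; :-_)

module OrderedField (ℝ : CompleteOrderedField) where
  open CompleteOrderedField ℝ renaming (Carrier to R) public
  open IsCommutativeRing isCommutativeRing public
    using (+-identityˡ; +-identityʳ; +-comm; *-identityˡ; *-identityʳ; *-assoc; zeroˡ; zeroʳ; -‿inverseʳ; distribˡ)
  commutativeRing : CommutativeRing _ _
  commutativeRing = record { isCommutativeRing = isCommutativeRing }
  open IntegerCoefficients commutativeRing public using (solve; _:=_; _:+_; _:*_; _:-_; :-_)
  open IsStrictTotalOrder isStrictTotalOrder public using (compare; _≟_) renaming (trans to <-trans; irrefl to <-irrefl)
  open Algebra.Properties.Ring (CommutativeRing.ring commutativeRing) public using (-0#≈0#; -‿involutive)

  2# 4# : R
  2# = 1# + 1#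
  4# = 2# * 2#

  +-pos : ∀ {x y} → 0# < x → 0# ≤ y → 0# < x + y
  +-pos {x} {y} 0<x (inj₁ 0<y) = <-trans 0<y (subst (_< x + y) (+-identityˡ y) (+-mono-< y 0<x))
  +-pos {x} 0<x (inj₂ refl) = subst (0# <_) (sym (+-identityʳ x)) 0<x

  +-nonneg : ∀ {x y} → 0# ≤ x → 0# ≤ y → 0# ≤ (x + y)
  +-nonneg (inj₁ 0<x) 0≤y = inj₁ (+-pos 0<x 0≤y)
  +-nonneg {y = y} (inj₂ refl) 0≤y = subst (0# ≤_) (sym (+-identityˡ y)) 0≤y

  *-nonneg : ∀ {x y} → 0# ≤ x → 0# ≤ y → 0# ≤ (x * y)
  *-nonneg (inj₁ 0<x) (inj₁ 0<y) = inj₁ (*-pos 0<x 0<y)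
  *-nonneg {y = y} (inj₂ refl) _ = inj₂ (sym (zeroˡ y))
  *-nonneg {x} _ (inj₂ refl) = inj₂ (sym (zeroʳ x))

  nonneg-sum-zero : ∀ {x y} → 0# ≤ x → 0# ≤ y → x + y ≡ 0# → x ≡ 0# × y ≡ 0#
  nonneg-sum-zero (inj₁ 0<x) 0≤y eq = ⊥-elim (<-irrefl (sym eq) (+-pos 0<x 0≤y))
  nonneg-sum-zero {y = y} (inj₂ refl) 0≤y eq = refl , trans (sym (+-identityˡ y)) eq

  0<2 : 0# < 2#
  0<2 = +-pos 0<1 (inj₁ 0<1)

  4≢0 : 4# ≢ 0#
  4≢0 eq = <-irrefl (sym eq) (*-pos 0<2 0<2)

  1≢0 : 1# ≢ 0#
  1≢0 eq = <-irrefl (sym eq) 0<1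

  1≢-1 : 1# ≢ - 1#
  1≢-1 eq = <-irrefl (trans (sym (-‿inverseʳ 1#)) (cong (1# +_) (sym eq))) 0<2

  *-cancelˡ : ∀ {x y z} → x ≢ 0# → x * y ≡ x * z → y ≡ z
  *-cancelˡ {x} {y} {z} x≢0 eq = begin
    y               ≡⟨ expand y ⟩
    x⁻¹ * (x * y)   ≡⟨ cong (x⁻¹ *_) eq ⟩
    x⁻¹ * (x * z)   ≡⟨ expand z ⟨
    z               ∎
    where
    open ≡-Reasoning
    x⁻¹ = proj₁ (inverse x x≢0)
    expand : ∀ w → w ≡ x⁻¹ * (x * w)
    expand w = begin
      w               ≡⟨ *-identityˡ w ⟨
      1# * w          ≡⟨ cong (_* w) (proj₂ (inverse x x≢0)) ⟨
      x * x⁻¹ * w     ≡⟨ solve 3 (λ a b c → a :* b :* c := b :* (a :* c)) refl x x⁻¹ w ⟩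
      x⁻¹ * (x * w)   ∎

  zero-product : ∀ x {y} → x * y ≡ 0# → x ≡ 0# ⊎ y ≡ 0#
  zero-product x eq with x ≟ 0#
  ... | yes x≡0 = inj₁ x≡0
  ... | no x≢0 = inj₂ (*-cancelˡ x≢0 (trans eq (sym (zeroʳ x))))

  x-y≡0⇒x≡y : ∀ {x y} → x + - y ≡ 0# → x ≡ y
  x-y≡0⇒x≡y {x} {y} eq = begin
    x               ≡⟨ solve 2 (λ x y → x := (x :- y) :+ y) refl x y ⟩
    (x + - y) + y   ≡⟨ cong (_+ y) eq ⟩
    0# + y          ≡⟨ +-identityˡ y ⟩
    y               ∎
    where open ≡-Reasoning

  x≡y⇒x-y≡0 : ∀ {x y} → x ≡ y → x + - y ≡ 0#
  x≡y⇒x-y≡0 {x} refl = -‿inverseʳ x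

  neg-pos : ∀ {x} → x < 0# → 0# < - x
  neg-pos {x} x<0 = subst₂ _<_ (-‿inverseʳ x) (+-identityˡ (- x)) (+-mono-< (- x) x<0)

  square-nonneg : ∀ x → 0# ≤ (x * x)
  square-nonneg x with compare 0# x
  ... | tri< 0<x _ _ = inj₁ (*-pos 0<x 0<x)
  ... | tri≈ _ refl _ = inj₂ (sym (zeroˡ 0#))
  ... | tri> _ _ x<0 = inj₁ (subst (0# <_) (solve 1 (λ x → (:- x) :* (:- x) := x :* x) refl x)
                               (*-pos (neg-pos x<0) (neg-pos x<0)))

  square-zero : ∀ x → x * x ≡ 0# → x ≡ 0#
  square-zero x eq with zero-product x eq
  ... | inj₁ p = p
  ... | inj₂ p = p

  -- Finite sums over lists

  module _ {A : Set} where

    ∑ : List A → (A → R) → R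
    ∑ L g = sum (map g L)

    ∑-cong : ∀ (L : List A) {g h} → (∀ {a} → a ∈ L → g a ≡ h a) → ∑ L g ≡ ∑ L h
    ∑-cong [] g≗h = refl
    ∑-cong (a ∷ L) g≗h = cong₂ _+_ (g≗h (here refl)) (∑-cong L (g≗h ∘ there))

    ∑-zero : ∀ (L : List A) → ∑ L (λ _ → 0#) ≡ 0#
    ∑-zero [] = refl
    ∑-zero (_ ∷ L) = trans (+-identityˡ _) (∑-zero L)

    ∑-minus : ∀ (L : List A) g h → ∑ L (λ a → g a + - h a) ≡ ∑ L g + - ∑ L h
    ∑-minus [] g h = sym (-‿inverseʳ 0#)
    ∑-minus (a ∷ L) g h = trans (cong ((g a + - h a) +_) (∑-minus L g h))
      (solve 4 (λ x y u v → (x :- y) :+ (u :- v) := (x :+ u) :- (y :+ v)) refl (g a) (h a) (∑ L g) (∑ L h))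

    ∑-neg : ∀ (L : List A) g → ∑ L (λ a → - g a) ≡ - ∑ L g
    ∑-neg [] g = sym -0#≈0#
    ∑-neg (a ∷ L) g = trans (cong (- g a +_) (∑-neg L g))
      (solve 2 (λ x s → (:- x) :+ (:- s) := :- (x :+ s)) refl (g a) (∑ L g))

    ∑-*ˡ : ∀ (L : List A) c g → ∑ L (λ a → c * g a) ≡ c * ∑ L g
    ∑-*ˡ [] c g = sym (zeroʳ c)
    ∑-*ˡ (a ∷ L) c g = trans (cong (c * g a +_) (∑-*ˡ L c g)) (sym (distribˡ c _ _))

    ∑-nonneg : ∀ {L : List A} {g} → All (λ a → 0# ≤ (g a)) L → 0# ≤ (∑ L g)
    ∑-nonneg [] = inj₂ refl
    ∑-nonneg (p ∷ ps) = +-nonneg p (∑-nonneg ps)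

    ∑-zero⁻¹ : ∀ {L : List A} {g} → All (λ a → 0# ≤ (g a)) L → ∑ L g ≡ 0# → All (λ a → g a ≡ 0#) L
    ∑-zero⁻¹ [] eq = []
    ∑-zero⁻¹ (p ∷ ps) eq = let (q , r) = nonneg-sum-zero p (∑-nonneg ps) eq in q ∷ ∑-zero⁻¹ ps r

    ∑-↭ : ∀ {L M : List A} g → L ↭ M → ∑ L g ≡ ∑ M g
    ∑-↭ g ↭.refl = refl
    ∑-↭ g (↭.prep x p) = cong (g x +_) (∑-↭ g p)
    ∑-↭ g (↭.swap {xs} {ys} x y p) = trans (cong (λ s → g x + (g y + s)) (∑-↭ g p))
      (solve 3 (λ x y s → x :+ (y :+ s) := y :+ (x :+ s)) refl (g x) (g y) (∑ ys g))
    ∑-↭ g (↭.trans p q) = trans (∑-↭ g p) (∑-↭ g q)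

    -- Removal of one occurrence of `a`, recorded through its effect on sums and membership; it
    -- isolates one coordinate in a squared distance.
    record Split (L : List A) (a : A) : Set where
      field
        rest       : List A
        ∑-split    : ∀ g → ∑ L g ≡ g a + ∑ rest g
        rest-≢     : ∀ {b} → b ∈ rest → b ≢ a
        rest-∈     : ∀ {b} → b ∈ L → b ≢ a → b ∈ rest

    split : ∀ {L a} → Unique L → a ∈ L → Split L a
    split {a ∷ L} (a∉L ∷ _) (here refl) = record
      { rest = L
      ; ∑-split = λ _ → refl
      ; rest-≢ = λ b∈L b≡a → All.lookup a∉L b∈L (sym b≡a)
      ; rest-∈ = λ { (here b≡a) b≢a → contradiction b≡a b≢a ; (there b∈L) _ → b∈L } }
    split {b ∷ L} {a} (b∉L ∷ L!) (there a∈L) = record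
      { rest = b ∷ S.rest
      ; ∑-split = λ g → trans (cong (g b +_) (S.∑-split g))
          (solve 3 (λ x y s → x :+ (y :+ s) := y :+ (x :+ s)) refl (g b) (g a) (∑ S.rest g))
      ; rest-≢ = λ { (here refl) b≡a → All.lookup b∉L a∈L b≡a ; (there c∈) → S.rest-≢ c∈ }
      ; rest-∈ = λ { (here c≡b) _ → here c≡b ; (there c∈) c≢a → there (S.rest-∈ c∈ c≢a) } }
      where module S = Split (split L! a∈L)

-- The polytope and its isometries

module LinearOrderingPolytope (ℝ : CompleteOrderedField) (n : ℕ) where
  open OrderedField ℝ
  open ≡-Reasoning

  V : Set
  V = Vec ℝ n

  infix 4 _≈_
  _≈_ : V → V → Set
  _≈_ = _≈V_ ℝ n

  v : Permutation′ n → V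
  v = vπ ℝ n

  e : V → Fin n → Fin n → R
  e = ext ℝ n

  d² : V → V → R
  d² = dist² ℝ n

  P : V → Set
  P = InLO ℝ n

  -- Coordinates extended to all ordered pairs

  ext-< : ∀ x {i j} (p : i <F j) → e x i j ≡ x (i , j , p)
  ext-< x {i} {j} p with i <? j | j <? i
  ... | yes q | _ = cong (λ r → x (i , j , r)) (<-irrelevant q p)
  ... | no i≮j | _ = contradiction p i≮j

  ext-> : ∀ x {i j} (p : j <F i) → e x i j ≡ - x (j , i , p)
  ext-> x {i} {j} p with i <? j | j <? i
  ... | yes q | _ = contradiction q (ℕ.<-asym p)
  ... | no _ | yes q = cong (λ r → - x (j , i , r)) (<-irrelevant q p)
  ... | no _ | no j≮i = contradiction p j≮i

  ext-diagonal : ∀ x i → e x i i ≡ 0#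
  ext-diagonal x i with i <? i
  ... | yes p = contradiction p (ℕ.<-irrefl refl)
  ... | no _ = refl

  ext-antisym : ∀ x i j → e x j i ≡ - e x i j
  ext-antisym x i j with <-cmp i j
  ... | tri< p _ _ = trans (ext-> x p) (cong -_ (sym (ext-< x p)))
  ... | tri≈ _ refl _ = trans (ext-diagonal x i) (trans (sym -0#≈0#) (cong -_ (sym (ext-diagonal x i))))
  ... | tri> _ _ p = trans (ext-< x p) (trans (sym (-‿involutive _)) (cong -_ (sym (ext-> x p))))

  -- An antisymmetric function with zero diagonal is determined by its values on increasing pairs,
  -- so identities between extended coordinates need checking only there.
  ext-induction : ∀ x (F : Fin n → Fin n → R) → (∀ i j → F j i ≡ - F i j) → (∀ i → F i i ≡ 0#) →
    (∀ i j (p : i <F j) → x (i , j , p) ≡ F i j) → ∀ i j → e x i j ≡ F i j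
  ext-induction x F anti diag eq i j with <-cmp i j
  ... | tri< p _ _ = trans (ext-< x p) (eq i j p)
  ... | tri≈ _ refl _ = trans (ext-diagonal x i) (sym (diag i))
  ... | tri> _ _ p = trans (ext-> x p) (trans (cong -_ (eq j i p)) (sym (anti j i)))

  ext-cong : ∀ {x y} → x ≈ y → ∀ i j → e x i j ≡ e y i j
  ext-cong {x} {y} x≈y = ext-induction x (e y) (ext-antisym y) (ext-diagonal y)
    (λ i j p → trans (x≈y (i , j , p)) (sym (ext-< y p)))

  ext-relabel : ∀ τ x i j → e (Relabel ℝ n τ x) i j ≡ e x (τ ⟨$⟩ʳ i) (τ ⟨$⟩ʳ j)
  ext-relabel τ x = ext-induction _ _
    (λ i j → ext-antisym x (τ ⟨$⟩ʳ i) (τ ⟨$⟩ʳ j)) (λ i → ext-diagonal x (τ ⟨$⟩ʳ i)) (λ i j p → refl)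

  ext-neg : ∀ x i j → e (λ p → - x p) i j ≡ - e x i j
  ext-neg x = ext-induction _ _ (λ i j → cong -_ (ext-antisym x i j))
    (λ i → trans (cong -_ (ext-diagonal x i)) -0#≈0#) (λ i j p → cong -_ (sym (ext-< x p)))

  -- Vertices as sign vectors

  IsSign : R → Set
  IsSign a = a ≡ 1# ⊎ a ≡ - 1#

  v-above : ∀ π {i j} → π ⟨$⟩ʳ j <F π ⟨$⟩ʳ i → e (v π) i j ≡ 1#
  v-above π {i} {j} j<i with <-cmp i j
  ... | tri< p _ _ = trans (ext-< (v π) p) lemma
    where
    lemma : v π (i , j , p) ≡ 1#
    lemma with π ⟨$⟩ʳ j <? π ⟨$⟩ʳ i
    ... | yes _ = refl
    ... | no ¬q = contradiction j<i ¬q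
  ... | tri≈ _ refl _ = contradiction j<i (ℕ.<-irrefl refl)
  ... | tri> _ _ p = trans (ext-> (v π) p) (trans (cong -_ lemma) (-‿involutive 1#))
    where
    lemma : v π (j , i , p) ≡ - 1#
    lemma with π ⟨$⟩ʳ i <? π ⟨$⟩ʳ j
    ... | yes q = contradiction q (ℕ.<-asym j<i)
    ... | no _ = refl

  v-below : ∀ π {i j} → π ⟨$⟩ʳ i <F π ⟨$⟩ʳ j → e (v π) i j ≡ - 1#
  v-below π {i} {j} i<j = trans (ext-antisym (v π) j i) (cong -_ (v-above π i<j))

  v-above⁻¹ : ∀ π {i j} → e (v π) i j ≡ 1# → π ⟨$⟩ʳ j <F π ⟨$⟩ʳ i
  v-above⁻¹ π {i} {j} eq with <-cmp (π ⟨$⟩ʳ i) (π ⟨$⟩ʳ j)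
  ... | tri< i<j _ _ = ⊥-elim (1≢-1 (trans (sym eq) (v-below π i<j)))
  ... | tri≈ _ i≡j _ with refl ← permutation-injective π i≡j = ⊥-elim (1≢0 (trans (sym eq) (ext-diagonal (v π) i)))
  ... | tri> _ _ j<i = j<i

  v-sign : ∀ π p → IsSign (v π p)
  v-sign π (i , j , _) with π ⟨$⟩ʳ j <? π ⟨$⟩ʳ i
  ... | yes _ = inj₁ refl
  ... | no _ = inj₂ refl

  dual : Permutation′ n → Permutation′ n
  dual π = π ∘ₚ reverse

  v-dual : ∀ π p → v (dual π) p ≡ - v π p
  v-dual π (i , j , p) = begin
    v (dual π) (i , j , p)   ≡⟨ ext-< (v (dual π)) p ⟨
    e (v (dual π)) i j       ≡⟨ cases ⟩
    - e (v π) i j            ≡⟨ cong -_ (ext-< (v π) p) ⟩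
    - v π (i , j , p)        ∎
    where
    cases : e (v (dual π)) i j ≡ - e (v π) i j
    cases with <-cmp (π ⟨$⟩ʳ i) (π ⟨$⟩ʳ j)
    ... | tri< i<j _ _ = trans (v-above (dual π) (opposite-< i<j))
      (trans (sym (-‿involutive 1#)) (cong -_ (sym (v-below π i<j))))
    ... | tri≈ _ i≡j _ = contradiction (permutation-injective π i≡j) (Fin.<⇒≢ p)
    ... | tri> _ _ j<i = trans (v-below (dual π) (opposite-< j<i)) (cong -_ (sym (v-above π j<i)))

  sign-square : ∀ {a} → IsSign a → a * a ≡ 1#
  sign-square (inj₁ refl) = *-identityˡ 1#
  sign-square (inj₂ refl) = trans (solve 1 (λ o → (:- o) :* (:- o) := o :* o) refl 1#) (*-identityˡ 1#)

  signs-agree : ∀ {a b} → IsSign a → IsSign b → a * b ≡ 1# → a ≡ b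
  signs-agree {a} {b} sa sb eq = begin
    a             ≡⟨ *-identityʳ a ⟨
    a * 1#        ≡⟨ cong (a *_) (sign-square sb) ⟨
    a * (b * b)   ≡⟨ *-assoc a b b ⟨
    a * b * b     ≡⟨ cong (_* b) eq ⟩
    1# * b        ≡⟨ *-identityˡ b ⟩
    b             ∎

  signs-differ : ∀ {a b} → IsSign a → IsSign b → a ≢ b → b ≡ - a
  signs-differ (inj₁ refl) (inj₁ refl) a≢b = contradiction refl a≢b
  signs-differ (inj₁ refl) (inj₂ refl) _ = refl
  signs-differ (inj₂ refl) (inj₁ refl) _ = sym (-‿involutive 1#)
  signs-differ (inj₂ refl) (inj₂ refl) a≢b = contradiction refl a≢b

  sign-slack : ∀ {a b} → IsSign a → IsSign b → 0# ≤ (1# + - (a * b))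
  sign-slack {a} {b} sa sb with a ≟ b
  ... | yes refl = inj₂ (sym (x≡y⇒x-y≡0 (sym (sign-square sa))))
  ... | no a≢b with refl ← signs-differ sa sb a≢b = inj₁ (subst (0# <_) (begin
      1# + 1#            ≡⟨ cong (1# +_) (sign-square sa) ⟨
      1# + a * a         ≡⟨ solve 2 (λ o a → o :+ a :* a := o :- a :* (:- a)) refl 1# a ⟩
      1# + - (a * - a)   ∎) 0<2)

  square-gap-zero : ∀ {a b} → a ≡ b → (a + - b) * (a + - b) ≡ 0#
  square-gap-zero a≡b = trans (cong (λ c → c * c) (x≡y⇒x-y≡0 a≡b)) (zeroˡ 0#)

  d²-cong : ∀ {x x′ y y′} → x ≈ x′ → y ≈ y′ → d² x y ≡ d² x′ y′
  d²-cong x≈x′ y≈y′ = ∑-cong (allPairs n) (λ {p} _ → cong₂ (λ a b → (a + - b) * (a + - b)) (x≈x′ p) (y≈y′ p))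

  d²-zero⁻¹ : ∀ {x y} → d² x y ≡ 0# → x ≈ y
  d²-zero⁻¹ {x} {y} eq p = x-y≡0⇒x≡y (square-zero _ (All.lookup
    (∑-zero⁻¹ (All.universal (λ p → square-nonneg (x p + - y p)) (allPairs n)) eq) (allPairs-complete p)))

  d²-refl : ∀ {x y} → x ≈ y → d² x y ≡ 0#
  d²-refl {x} {y} x≈y = trans (∑-cong (allPairs n) (λ {p} _ → square-gap-zero (x≈y p)))
    (∑-zero (allPairs n))

  -- Convex combinations, the surrounding cube and diametral pairs

  v∈P : ∀ π → P (v π)
  v∈P π = (π , 1#) ∷ [] , inj₁ 0<1 ∷ [] , +-identityʳ 1# ,
    λ p → sym (trans (+-identityʳ _) (*-identityˡ _))

  -- The weights sum to `1#`, so an affine function of the combination is the weighted mean of its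
  -- values at the vertices.
  slack : ∀ (L : List (Permutation′ n × R)) ε p → ∑ L proj₂ ≡ 1# →
    ∑ L (λ c → proj₂ c * (1# + - (ε * v (proj₁ c) p))) ≡ 1# + - (ε * ∑ L (λ c → proj₂ c * v (proj₁ c) p))
  slack L ε p ∑c = begin
    ∑ L (λ c → proj₂ c * (1# + - (ε * v (proj₁ c) p)))
      ≡⟨ ∑-cong L (λ {c} _ → trans
           (solve 4 (λ o ε c x → c :* (o :- ε :* x) := o :* c :- ε :* (c :* x)) refl 1# ε (proj₂ c) (v (proj₁ c) p))
           (cong (_+ - (ε * (proj₂ c * v (proj₁ c) p))) (*-identityˡ (proj₂ c)))) ⟩
    ∑ L (λ c → proj₂ c + - (ε * (proj₂ c * v (proj₁ c) p)))
      ≡⟨ ∑-minus L proj₂ (λ c → ε * (proj₂ c * v (proj₁ c) p)) ⟩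
    ∑ L proj₂ + - ∑ L (λ c → ε * (proj₂ c * v (proj₁ c) p))
      ≡⟨ cong₂ (λ a b → a + - b) ∑c (∑-*ˡ L ε (λ c → proj₂ c * v (proj₁ c) p)) ⟩
    1# + - (ε * ∑ L (λ c → proj₂ c * v (proj₁ c) p)) ∎

  slack-terms : ∀ (L : List (Permutation′ n × R)) {ε} p → IsSign ε → All (λ c → 0# ≤ proj₂ c) L →
    All (λ c → 0# ≤ (proj₂ c * (1# + - (ε * v (proj₁ c) p)))) L
  slack-terms L p sε = All.map (λ {c} 0≤c → *-nonneg 0≤c (sign-slack sε (v-sign (proj₁ c) p)))

  -- Taking both signs for `ε` confines the polytope to the cube with coordinates between `- 1#` and
  -- `1#`; the slack is a nonnegative combination of slacks at vertices.
  P-slack : ∀ {x} → P x → ∀ {ε} → IsSign ε → ∀ p → 0# ≤ (1# + - (ε * x p))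
  P-slack {x} (L , c≥0 , ∑c , eq) {ε} sε p = subst (0# ≤_)
    (trans (slack L ε p ∑c) (cong (λ a → 1# + - (ε * a)) (sym (eq p)))) (∑-nonneg (slack-terms L p sε c≥0))

  P-upper : ∀ {x} → P x → ∀ p → 0# ≤ (1# + - x p)
  P-upper {x} x∈P p = subst (0# ≤_) (cong (λ a → 1# + - a) (*-identityˡ (x p))) (P-slack x∈P (inj₁ refl) p)

  P-lower : ∀ {x} → P x → ∀ p → 0# ≤ (1# + x p)
  P-lower {x} x∈P p = subst (0# ≤_) (trans
    (solve 2 (λ o x → o :- (:- o) :* x := o :+ o :* x) refl 1# (x p))
    (cong (1# +_) (*-identityˡ (x p)))) (P-slack x∈P (inj₂ refl) p)

  nonzero-term : ∀ {A : Set} (L : List A) (g : A → R) → ∑ L g ≢ 0# → ∃[ a ] (a ∈ L × g a ≢ 0#)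
  nonzero-term [] g ∑≢0 = contradiction refl ∑≢0
  nonzero-term (a ∷ L) g ∑≢0 with g a ≟ 0#
  ... | no ga≢0 = a , here refl , ga≢0
  ... | yes ga≡0 with (b , b∈ , gb≢0) ← nonzero-term L g (λ eq → ∑≢0 (trans (cong₂ _+_ ga≡0 eq) (+-identityˡ 0#)))
    = b , there b∈ , gb≢0

  -- In a convex combination with all coordinates ±1, every vertex of nonzero weight is the combination itself.
  sign-vector∈P⇒vertex : ∀ {x} → P x → (∀ p → IsSign (x p)) → ∃[ ρ ] (v ρ ≈ x)
  sign-vector∈P⇒vertex {x} (L , c≥0 , ∑c , eq) sx =
    let ((ρ , c) , c∈L , c≢0) = nonzero-term L proj₂ (λ ∑≡0 → 1≢0 (trans (sym ∑c) ∑≡0))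
    in ρ , λ p → sym (agree c∈L c≢0 p)
    where
    no-slack : ∀ p → ∑ L (λ c → proj₂ c * (1# + - (x p * v (proj₁ c) p))) ≡ 0#
    no-slack p = begin
      ∑ L (λ c → proj₂ c * (1# + - (x p * v (proj₁ c) p)))   ≡⟨ slack L (x p) p ∑c ⟩
      1# + - (x p * ∑ L (λ c → proj₂ c * v (proj₁ c) p))     ≡⟨ cong (λ a → 1# + - (x p * a)) (eq p) ⟨
      1# + - (x p * x p)                                     ≡⟨ x≡y⇒x-y≡0 (sym (sign-square (sx p))) ⟩
      0#                                                     ∎
    agree : ∀ {ρ c} → (ρ , c) ∈ L → c ≢ 0# → ∀ p → x p ≡ v ρ p
    agree {ρ} {c} c∈L c≢0 p =
      [ (λ c≡0 → contradiction c≡0 c≢0)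
      , (λ s≡0 → signs-agree (sx p) (v-sign ρ p) (sym (x-y≡0⇒x≡y s≡0))) ]′
      (zero-product c (All.lookup (∑-zero⁻¹ (slack-terms L p (sx p) c≥0) (no-slack p)) c∈L))

  -- The squared length of a main diagonal of the cube: each coordinate contributes the square of
  -- two.
  diameter² : R
  diameter² = ∑ (allPairs n) (λ _ → 4#)

  difference-of-squares : ∀ o x y →
    ((o + - x) + (o + y)) * ((o + x) + (o + - y)) ≡ (o + o) * (o + o) + - ((x + - y) * (x + - y))
  difference-of-squares = solve 3 (λ o x y → ((o :- x) :+ (o :+ y)) :* ((o :+ x) :+ (o :- y)) :=
      (o :+ o) :* (o :+ o) :- (x :- y) :* (x :- y)) refl

  -- 4 − (x p − y p)² factors as (2 − (x p − y p)) (2 + (x p − y p)), both nonnegative on the cube, so a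
  -- diametral pair makes one factor vanish in every coordinate.
  diametral⇒sign-vector : ∀ {x y} → P x → P y → d² x y ≡ diameter² → ∀ p → IsSign (x p)
  diametral⇒sign-vector {x} {y} x∈P y∈P eq p = conclusion
    where
    a b : V
    a p = (1# + - x p) + (1# + y p)
    b p = (1# + x p) + (1# + - y p)
    factor : ∀ p → a p * b p ≡ 4# + - ((x p + - y p) * (x p + - y p))
    factor p = difference-of-squares 1# (x p) (y p)
    zeros : All (λ p → a p * b p ≡ 0#) (allPairs n)
    zeros = ∑-zero⁻¹ (All.universal (λ p → *-nonneg (+-nonneg (P-upper x∈P p) (P-lower y∈P p))
                                                     (+-nonneg (P-lower x∈P p) (P-upper y∈P p))) (allPairs n))
      (begin
        ∑ (allPairs n) (λ p → a p * b p)   ≡⟨ ∑-cong (allPairs n) (λ {p} _ → factor p) ⟩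
        ∑ (allPairs n) (λ p → 4# + - ((x p + - y p) * (x p + - y p)))   ≡⟨ ∑-minus (allPairs n) _ _ ⟩
        diameter² + - d² x y   ≡⟨ x≡y⇒x-y≡0 (sym eq) ⟩
        0#   ∎)
    conclusion : IsSign (x p)
    conclusion =
      [ (λ a≡0 → inj₁ (sym (x-y≡0⇒x≡y (proj₁ (nonneg-sum-zero (P-upper x∈P p) (P-lower y∈P p) a≡0)))))
      , (λ b≡0 → inj₂ (x-y≡0⇒x≡y (trans (trans (cong (x p +_) (-‿involutive 1#)) (+-comm (x p) 1#))
                   (proj₁ (nonneg-sum-zero (P-lower x∈P p) (P-upper y∈P p) b≡0))))) ]′
      (zero-product (a p) (All.lookup zeros (allPairs-complete p)))

  sign-gap : ∀ {a b} → IsSign a → b ≡ - a → (a + - b) * (a + - b) ≡ 4#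
  sign-gap {a} sa refl = begin
    (a + - (- a)) * (a + - (- a))
      ≡⟨ solve 1 (λ a → (a :- (:- a)) :* (a :- (:- a)) := (a :* a :+ a :* a) :+ (a :* a :+ a :* a)) refl a ⟩
    (a * a + a * a) + (a * a + a * a)
      -- The product `a * a` becomes `1# * 1#` and not `1#`: the solver treats the `1#` inside `4#`
      -- as a variable, so both sides must have degree two in it.
      ≡⟨ cong (λ s → (s + s) + (s + s)) (trans (sign-square sa) (sym (*-identityˡ 1#))) ⟩
    (1# * 1# + 1# * 1#) + (1# * 1# + 1# * 1#)
      ≡⟨ solve 1 (λ o → (o :* o :+ o :* o) :+ (o :* o :+ o :* o) := (o :+ o) :* (o :+ o)) refl 1# ⟩
    4#   ∎

  dual-diametral : ∀ π → d² (v π) (v (dual π)) ≡ diameter²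
  dual-diametral π = ∑-cong (allPairs n) (λ {p} _ → sign-gap (v-sign π p) (v-dual π p))

  -- The ends of `q` are placed lowest in either order while all other elements keep their natural
  -- order, so only the comparison at `q` differs.
  adjacent-vertices : ∀ q → ∃[ π ] ∃[ ρ ] (v π q ≡ 1# × v ρ q ≡ - 1# × (∀ p → p ≢ q → v π p ≡ v ρ p))
  adjacent-vertices q@(i , j , i<j) =
    let i≢j = Fin.<⇒≢ i<j
        (π , π-ij , π-low , π-mono) = lowered₂ i≢j
        (ρ , ρ-ji , ρ-low , ρ-mono) = lowered₂ (i≢j ∘ sym)
    in π , ρ , trans (sym (ext-< (v π) i<j)) (v-above π π-ij) , trans (sym (ext-< (v ρ) i<j)) (v-below ρ ρ-ji) ,
      agree π ρ π-low π-mono ρ-low ρ-mono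
    where
    both-below : ∀ π ρ {k l} (k<l : k <F l) → π ⟨$⟩ʳ k <F π ⟨$⟩ʳ l → ρ ⟨$⟩ʳ k <F ρ ⟨$⟩ʳ l →
      v π (k , l , k<l) ≡ v ρ (k , l , k<l)
    both-below π ρ k<l π< ρ< = trans (sym (ext-< (v π) k<l))
      (trans (v-below π π<) (trans (sym (v-below ρ ρ<)) (ext-< (v ρ) k<l)))
    both-above : ∀ π ρ {k l} (k<l : k <F l) → π ⟨$⟩ʳ l <F π ⟨$⟩ʳ k → ρ ⟨$⟩ʳ l <F ρ ⟨$⟩ʳ k →
      v π (k , l , k<l) ≡ v ρ (k , l , k<l)
    both-above π ρ k<l π< ρ< = trans (sym (ext-< (v π) k<l))
      (trans (v-above π π<) (trans (sym (v-above ρ ρ<)) (ext-< (v ρ) k<l)))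
    Low Mono : Fin n → Fin n → Permutation′ n → Set
    Low a b π = ∀ {k l} → k ≡ a ⊎ k ≡ b → l ≢ a → l ≢ b → π ⟨$⟩ʳ k <F π ⟨$⟩ʳ l
    Mono a b π = ∀ {k l} → k ≢ a → k ≢ b → l ≢ a → l ≢ b → k <F l → π ⟨$⟩ʳ k <F π ⟨$⟩ʳ l
    agree : ∀ π ρ → Low i j π → Mono i j π → Low j i ρ → Mono j i ρ → ∀ p → p ≢ q → v π p ≡ v ρ p
    agree π ρ π-low π-mono ρ-low ρ-mono (k , l , k<l) p≢q with among? i j k | among? i j l
    ... | inj₁ (inj₁ refl) | inj₁ (inj₁ refl) = contradiction k<l (ℕ.<-irrefl refl)
    ... | inj₁ (inj₁ refl) | inj₁ (inj₂ refl) = contradiction (pair-≡ refl refl) p≢q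
    ... | inj₁ (inj₂ refl) | inj₁ (inj₁ refl) = contradiction k<l (ℕ.<-asym i<j)
    ... | inj₁ (inj₂ refl) | inj₁ (inj₂ refl) = contradiction k<l (ℕ.<-irrefl refl)
    ... | inj₁ k∈ | inj₂ (l≢i , l≢j) = both-below π ρ k<l (π-low k∈ l≢i l≢j) (ρ-low (Sum.swap k∈) l≢j l≢i)
    ... | inj₂ (k≢i , k≢j) | inj₁ l∈ = both-above π ρ k<l (π-low l∈ k≢i k≢j) (ρ-low (Sum.swap l∈) k≢j k≢i)
    ... | inj₂ (k≢i , k≢j) | inj₂ (l≢i , l≢j) =
      both-below π ρ k<l (π-mono k≢i k≢j l≢i l≢j k<l) (ρ-mono k≢j k≢i l≢j l≢i k<l)

  -- Single coordinates from squared distances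

  term : V → V → Pair n → R
  term x y p = (x p + - y p) * (x p + - y p)

  d²-adjacent : ∀ {u w} q → IsSign (u q) → w q ≡ - u q → (∀ p → p ≢ q → u p ≡ w p) → d² u w ≡ 4#
  d²-adjacent {u} {w} q su wq≡ agree = begin
    d² u w                              ≡⟨ S.∑-split (term u w) ⟩
    term u w q + ∑ S.rest (term u w)    ≡⟨ cong₂ _+_ (sign-gap su wq≡)
                                             (∑-cong S.rest (λ {p} p∈ → square-gap-zero (agree p (S.rest-≢ p∈)))) ⟩
    4# + ∑ S.rest (λ _ → 0#)            ≡⟨ cong (4# +_) (∑-zero S.rest) ⟩
    4# + 0#                             ≡⟨ +-identityʳ 4# ⟩
    4#                                  ∎
    where module S = Split (split allPairs-unique (allPairs-complete q))

  -- A coordinate where the signs differ already contributes `4#`, so the squares at the remaining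
  -- coordinates sum to zero.
  d²-adjacent⁻¹ : ∀ {u w} → (∀ p → IsSign (u p)) → (∀ p → IsSign (w p)) → d² u w ≡ 4# →
    ∃[ q ] (w q ≡ - u q × (∀ p → p ≢ q → u p ≡ w p))
  d²-adjacent⁻¹ {u} {w} su sw eq =
    let (q , _ , q-term≢0) = nonzero-term (allPairs n) (term u w) (λ eq₀ → 4≢0 (trans (sym eq) eq₀))
        wq≡ = signs-differ (su q) (sw q) (q-term≢0 ∘ square-gap-zero)
    in q , wq≡ , agree q wq≡
    where
    agree : ∀ q → w q ≡ - u q → ∀ p → p ≢ q → u p ≡ w p
    agree q wq≡ p p≢q = x-y≡0⇒x≡y (square-zero _ (All.lookup
      (∑-zero⁻¹ (All.universal (λ p → square-nonneg (u p + - w p)) S.rest) rest≡0)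
      (S.rest-∈ (allPairs-complete p) p≢q)))
      where
      module S = Split (split allPairs-unique (allPairs-complete q))
      rest≡0 : ∑ S.rest (term u w) ≡ 0#
      rest≡0 = begin
        ∑ S.rest (term u w)                   ≡⟨ solve 2 (λ f s → s := (f :+ s) :- f) refl 4# _ ⟩
        (4# + ∑ S.rest (term u w)) + - 4#     ≡⟨ cong (λ a → (a + ∑ S.rest (term u w)) + - 4#) (sign-gap (su q) wq≡) ⟨
        (term u w q + ∑ S.rest (term u w)) + - 4#   ≡⟨ cong (_+ - 4#) (S.∑-split (term u w)) ⟨
        d² u w + - 4#   ≡⟨ x≡y⇒x-y≡0 eq ⟩
        0#   ∎

  polarization : ∀ x u → (x + - (- u)) * (x + - (- u)) + - ((x + - u) * (x + - u)) ≡
    u * x + u * x + (u * x + u * x)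
  polarization = solve 2 (λ x u → (x :- (:- u)) :* (x :- (:- u)) :- (x :- u) :* (x :- u) :=
    u :* x :+ u :* x :+ (u :* x :+ u :* x)) refl

  -- A coordinate is a difference of squared distances to two adjacent vertices, hence determined by the metric.
  coordinate-from-distances : ∀ {u w} q → w q ≡ - u q → (∀ p → p ≢ q → u p ≡ w p) →
    ∀ x → d² x w + - d² x u ≡ 4# * (u q * x q)
  coordinate-from-distances {u} {w} q wq≡ agree x = begin
    d² x w + - d² x u   ≡⟨ cong₂ (λ a b → a + - b) (S.∑-split (term x w)) (S.∑-split (term x u)) ⟩
    (term x w q + ∑ S.rest (term x w)) + - (term x u q + ∑ S.rest (term x u))
      ≡⟨ cong (λ s → (term x w q + s) + - (term x u q + ∑ S.rest (term x u)))
           (∑-cong S.rest (λ {p} p∈ → cong (λ a → (x p + - a) * (x p + - a)) (sym (agree p (S.rest-≢ p∈))))) ⟩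
    (term x w q + ∑ S.rest (term x u)) + - (term x u q + ∑ S.rest (term x u))
      ≡⟨ solve 3 (λ a b s → (a :+ s) :- (b :+ s) := a :- b) refl (term x w q) (term x u q) (∑ S.rest (term x u)) ⟩
    term x w q + - term x u q   ≡⟨ cong (λ a → (x q + - a) * (x q + - a) + - term x u q) wq≡ ⟩
    (x q + - (- u q)) * (x q + - (- u q)) + - term x u q   ≡⟨ polarization (x q) (u q) ⟩
    z + z + (z + z)   ≡⟨ cong (λ z → z + z + (z + z)) (trans (*-identityˡ (1# * z)) (*-identityˡ z)) ⟨
    y + y + (y + y)
      ≡⟨ solve 2 (λ o z → o :* (o :* z) :+ o :* (o :* z) :+ (o :* (o :* z) :+ o :* (o :* z)) :=
            (o :+ o) :* (o :+ o) :* z) refl 1# z ⟩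
    4# * z ∎
    where
    module S = Split (split allPairs-unique (allPairs-complete q))
    z y : R
    z = u q * x q
    y = 1# * (1# * z)

  -- If the arcs differ and `k′`, `l′` are distinct, then `(k , l)` and `(l′ , k′)` are not
  -- antiparallel; an order making both forward gives the two coordinates opposite signs. If `k′`
  -- equals `l′`, that coordinate is zero, whereas some vertex has `1#` at `(k , l)`.
  vertices-separate-arcs : ∀ {k l k′ l′} → k ≢ l → (∀ π → e (v π) k l ≡ e (v π) k′ l′) → k ≡ k′ × l ≡ l′
  vertices-separate-arcs {k} {l} {k′} {l′} k≢l eq with k Fin.≟ k′ | l Fin.≟ l′ | l′ Fin.≟ k′
  ... | yes p | yes q | _ = p , q
  ... | _ | _ | yes refl with (π , kl ∷ []) ← orderable-∷ k≢l [] (idₚ , []) =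
    ⊥-elim (1≢0 (trans (sym (v-above π kl)) (trans (eq π) (ext-diagonal (v π) k′))))
  ... | no k≢k′ | _ | no l′≢k′ = ⊥-elim (impossible k≢l l′≢k′ (λ (p , q) → k≢k′ (sym q)) eq)
    where
    impossible : ∀ {k l k′ l′} → k ≢ l → l′ ≢ k′ → ¬ Antiparallel (k , l) (l′ , k′) →
      ¬ (∀ π → e (v π) k l ≡ e (v π) k′ l′)
    impossible k≢l l′≢k′ ¬anti eq with (π , kl ∷ l′k′ ∷ []) ← orderable₂ k≢l l′≢k′ ¬anti =
      1≢-1 (trans (sym (v-above π kl)) (trans (eq π) (v-below π l′k′)))
  ... | _ | no l≢l′ | no l′≢k′ with (π , kl ∷ l′k′ ∷ []) ← orderable₂ k≢l l′≢k′ (λ (p , q) → l≢l′ p) =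
    ⊥-elim (1≢-1 (trans (sym (v-above π kl)) (trans (eq π) (v-below π l′k′))))

  -- Coordinates of an automorphism

  module Automorphism (f : V → V) (f-isometry : Isometry ℝ n f)
    (f-into : ∀ x → P x → P (f x)) (f-onto : ∀ y → P y → ∃[ x ] (P x × f x ≈ y)) where

    -- Pointwise equality of vectors means distance zero, which an isometry preserves.
    f-cong : ∀ {x y} → x ≈ y → f x ≈ f y
    f-cong {x} {y} x≈y = d²-zero⁻¹ (trans (f-isometry x y) (d²-refl x≈y))

    vertex-image : ∀ π → ∃[ ρ ] (v ρ ≈ f (v π))
    vertex-image π = sign-vector∈P⇒vertex (f-into _ (v∈P π))
      (diametral⇒sign-vector (f-into _ (v∈P π)) (f-into _ (v∈P (dual π)))
        (trans (f-isometry (v π) (v (dual π))) (dual-diametral π)))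

    -- Preimages in the polytope of a vertex and its dual are again a diametral pair, hence sign
    -- vectors.
    vertex-preimage : ∀ π → ∃[ ρ ] (f (v ρ) ≈ v π)
    vertex-preimage π =
      let (x , x∈P , fx≈) = f-onto (v π) (v∈P π)
          (y , y∈P , fy≈) = f-onto (v (dual π)) (v∈P (dual π))
          (ρ , ρ≈x) = sign-vector∈P⇒vertex x∈P (diametral⇒sign-vector x∈P y∈P (begin
            d² x y                  ≡⟨ f-isometry x y ⟨
            d² (f x) (f y)          ≡⟨ d²-cong fx≈ fy≈ ⟩
            d² (v π) (v (dual π))   ≡⟨ dual-diametral π ⟩
            diameter²               ∎))
      in ρ , λ p → trans (f-cong ρ≈x p) (fx≈ p)

    -- Four times each side is a difference of squared distances to two vectors that differ in one
    -- coordinate; `f` carries one pair to the other and so preserves the difference.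
    compare-coordinates : ∀ {u w u′ w′ p q} → f u ≈ u′ → f w ≈ w′ →
      w p ≡ - u p → (∀ r → r ≢ p → u r ≡ w r) → w′ q ≡ - u′ q → (∀ r → r ≢ q → u′ r ≡ w′ r) →
      ∀ x → u′ q * f x q ≡ u p * x p
    compare-coordinates {u} {w} {u′} {w′} {p} {q} fu≈ fw≈ wp u≗w w′q u′≗w′ x = *-cancelˡ 4≢0 (begin
      4# * (u′ q * f x q)             ≡⟨ coordinate-from-distances q w′q u′≗w′ (f x) ⟨
      d² (f x) w′ + - d² (f x) u′     ≡⟨ cong₂ (λ a b → a + - b) (transport fw≈) (transport fu≈) ⟩
      d² x w + - d² x u               ≡⟨ coordinate-from-distances p wp u≗w x ⟩
      4# * (u p * x p)                ∎)
      where
      transport : ∀ {y y′} → f y ≈ y′ → d² (f x) y′ ≡ d² x y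
      transport {y} fy≈ = trans (d²-cong (λ _ → refl) (λ r → sym (fy≈ r))) (f-isometry x y)

    coordinate′ : ∀ {q} π ρ α β → f (v α) ≈ v π → f (v β) ≈ v ρ →
      v π q ≡ 1# → v ρ q ≡ - v π q → (∀ r → r ≢ q → v π r ≡ v ρ r) →
      ∃[ p ] (v β p ≡ - v α p × (∀ r → r ≢ p → v α r ≡ v β r)) →
      ∃[ p ] ∃[ ε ] (IsSign ε × (∀ x → f x q ≡ ε * x p))
    coordinate′ {q} π ρ α β fα≈π fβ≈ρ πq ρq π≗ρ (p , βp , α≗β) = p , v α p , v-sign α p , λ x → begin
      f x q            ≡⟨ *-identityˡ (f x q) ⟨
      1# * f x q       ≡⟨ cong (_* f x q) πq ⟨
      v π q * f x q    ≡⟨ compare-coordinates fα≈π fβ≈ρ βp α≗β ρq π≗ρ x ⟩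
      v α p * x p      ∎

    abstract
      -- Two vertices that differ only at `q` have vertex preimages at squared distance `4#`, which
      -- therefore differ only at some `p`; the sign `ε` is the `p` coordinate of the first
      -- preimage.
      coordinate : ∀ q → ∃[ p ] ∃[ ε ] (IsSign ε × (∀ x → f x q ≡ ε * x p))
      coordinate q = from-adjacent (adjacent-vertices q)
        where
        from-preimages : ∀ π ρ → v π q ≡ 1# → v ρ q ≡ - v π q → (∀ r → r ≢ q → v π r ≡ v ρ r) →
          ∃[ α ] (f (v α) ≈ v π) → ∃[ β ] (f (v β) ≈ v ρ) → ∃[ p ] ∃[ ε ] (IsSign ε × (∀ x → f x q ≡ ε * x p))
        from-preimages π ρ πq ρq π≗ρ (α , fα≈π) (β , fβ≈ρ) =
          coordinate′ π ρ α β fα≈π fβ≈ρ πq ρq π≗ρ (d²-adjacent⁻¹ (v-sign α) (v-sign β) (begin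
            d² (v α) (v β)           ≡⟨ f-isometry (v α) (v β) ⟨
            d² (f (v α)) (f (v β))   ≡⟨ d²-cong fα≈π fβ≈ρ ⟩
            d² (v π) (v ρ)           ≡⟨ d²-adjacent q (v-sign π q) ρq π≗ρ ⟩
            4#                       ∎))
        from-adjacent : ∃[ π ] ∃[ ρ ] (v π q ≡ 1# × v ρ q ≡ - 1# × (∀ p → p ≢ q → v π p ≡ v ρ p)) →
          ∃[ p ] ∃[ ε ] (IsSign ε × (∀ x → f x q ≡ ε * x p))
        from-adjacent (π , ρ , πq , ρq , π≗ρ) =
          from-preimages π ρ πq (trans ρq (cong -_ (sym πq))) π≗ρ (vertex-preimage π) (vertex-preimage ρ)

    -- The induced map of arcs

    T : Fin n → Fin n → Fin n → Fin n → Set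
    T i j k l = ∀ x → e (f x) i j ≡ e x k l

    T-rev : ∀ {a b k l} → T a b k l → T b a l k
    T-rev {a} {b} {k} {l} t x = trans (ext-antisym (f x) a b) (trans (cong -_ (t x)) (sym (ext-antisym x k l)))

    T-total-< : ∀ {i j} → i <F j → ∃[ k ] ∃[ l ] T i j k l
    T-total-< {i} {j} i<j with coordinate (i , j , i<j)
    ... | (k , l , k<l) , _ , inj₁ refl , eq = k , l , λ x →
      trans (ext-< (f x) i<j) (trans (eq x) (trans (*-identityˡ _) (sym (ext-< x k<l))))
    -- A negative sign is absorbed by reversing the arc.
    ... | (k , l , k<l) , _ , inj₂ refl , eq = l , k , λ x →
      trans (ext-< (f x) i<j) (trans (eq x) (trans
        (solve 2 (λ o x → (:- o) :* x := :- (o :* x)) refl 1# (x (k , l , k<l)))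
        (trans (cong -_ (*-identityˡ _)) (sym (ext-> x k<l)))))

    T-total : ∀ {i j} → i ≢ j → ∃[ k ] ∃[ l ] T i j k l
    T-total {i} {j} i≢j with <-cmp i j
    ... | tri< i<j _ _ = T-total-< i<j
    ... | tri≈ _ i≡j _ = contradiction i≡j i≢j
    ... | tri> _ _ j<i with (k , l , t) ← T-total-< j<i = l , k , T-rev {j} {i} {k} {l} t

    T-nondegenerate : ∀ {a b k} → a ≢ b → ¬ T a b k k
    T-nondegenerate {a} {b} {k} a≢b t =
      let (π , ab) = orderable-∷ a≢b [] (idₚ , [])
          (ρ , fρ≈π) = vertex-preimage π
      in 1≢0 (begin
        1#               ≡⟨ v-above π (All.head ab) ⟨
        e (v π) a b      ≡⟨ ext-cong fρ≈π a b ⟨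
        e (f (v ρ)) a b  ≡⟨ t (v ρ) ⟩
        e (v ρ) k k      ≡⟨ ext-diagonal (v ρ) k ⟩
        0#               ∎)

    T-distinct : ∀ {a b k l} → a ≢ b → T a b k l → k ≢ l
    T-distinct {a} {b} {k} a≢b t refl = T-nondegenerate {a} {b} {k} a≢b t

    T-functional : ∀ {a b k l k′ l′} → a ≢ b → T a b k l → T a b k′ l′ → k ≡ k′ × l ≡ l′
    T-functional {a} {b} {k} {l} a≢b t t′ = vertices-separate-arcs (T-distinct {a} {b} {k} {l} a≢b t)
      (λ π → trans (sym (t (v π))) (t′ (v π)))

    -- Every vertex is the image of a vertex, so a common image arc makes the coordinates at
    -- `(a , b)` and `(c , d)` agree on all vertices, and these separate arcs.
    T-injective : ∀ {a b c d k l} → a ≢ b → T a b k l → T c d k l → a ≡ c × b ≡ d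
    T-injective {a} {b} {c} {d} {k} {l} a≢b t t′ = vertices-separate-arcs a≢b λ π →
      let (ρ , fρ≈π) = vertex-preimage π in begin
        e (v π) a b       ≡⟨ ext-cong fρ≈π a b ⟨
        e (f (v ρ)) a b   ≡⟨ t (v ρ) ⟩
        e (v ρ) k l       ≡⟨ t′ (v ρ) ⟨
        e (f (v ρ)) c d   ≡⟨ ext-cong fρ≈π c d ⟩
        e (v π) c d       ∎

    -- Otherwise, after a reversal, `(a , b)` and `(c , b)` would have the same image.
    T-not-antiparallel : ∀ {a b c k l k′ l′} → a ≢ b → c ≢ a → T a b k l → T b c k′ l′ →
      ¬ Antiparallel (k , l) (k′ , l′)
    T-not-antiparallel {a} {b} {c} {k} {l} a≢b c≢a t t′ (refl , refl) =
      c≢a (sym (proj₁ (T-injective {a} {b} {c} {b} {k} {l} a≢b t (T-rev {b} {c} {l} {k} t′))))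

    -- If `π` made all three images forward, the vertex `f (v π)` would rank `a` above `b`, `b`
    -- above `c` and `c` above `a`.
    no-image-order : ∀ {a b c k₁ l₁ k₂ l₂ k₃ l₃} → T a b k₁ l₁ → T b c k₂ l₂ → T c a k₃ l₃ →
      ¬ Orderable ((k₁ , l₁) ∷ (k₂ , l₂) ∷ (k₃ , l₃) ∷ [])
    no-image-order {a} {b} {c} t₁ t₂ t₃ (π , o₁ ∷ o₂ ∷ o₃ ∷ []) =
      let (ρ , ρ≈fπ) = vertex-image π
          b<a = v-above⁻¹ ρ {a} {b} (trans (ext-cong ρ≈fπ a b) (trans (t₁ (v π)) (v-above π o₁)))
          c<b = v-above⁻¹ ρ {b} {c} (trans (ext-cong ρ≈fπ b c) (trans (t₂ (v π)) (v-above π o₂)))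
          a<c = v-above⁻¹ ρ {c} {a} (trans (ext-cong ρ≈fπ c a) (trans (t₃ (v π)) (v-above π o₃)))
      in ℕ.<-asym a<c (ℕ.<-trans c<b b<a)

    -- The three images admit no common order, so by `orderable₃` they form a directed cycle; its
    -- two senses are the two alternatives.
    triangle : ∀ {a b c} → a ≢ b → b ≢ c → c ≢ a →
      (∃[ x ] ∃[ y ] ∃[ z ] (T a b x y × T b c y z × T c a z x)) ⊎
      (∃[ x ] ∃[ y ] ∃[ z ] (T a b y x × T b c z y × T c a x z))
    triangle {a} {b} {c} a≢b b≢c c≢a with T-total a≢b | T-total b≢c | T-total c≢a
    ... | k₁ , l₁ , t₁ | k₂ , l₂ , t₂ | k₃ , l₃ , t₃
      with orderable₃ (T-distinct {a} {b} {k₁} {l₁} a≢b t₁) (T-distinct {b} {c} {k₂} {l₂} b≢c t₂)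
             (T-distinct {c} {a} {k₃} {l₃} c≢a t₃)
             (T-not-antiparallel {a} {b} {c} a≢b c≢a t₁ t₂) (T-not-antiparallel {b} {c} {a} b≢c a≢b t₂ t₃)
             (T-not-antiparallel {c} {a} {b} c≢a b≢c t₃ t₁)
    ...   | inj₁ orderable = ⊥-elim (no-image-order {a} {b} {c} t₁ t₂ t₃ orderable)
    ...   | inj₂ (inj₁ (refl , refl , refl)) = inj₁ (k₁ , l₁ , l₂ , t₁ , t₂ , t₃)
    ...   | inj₂ (inj₂ (refl , refl , refl)) = inj₂ (l₁ , k₁ , l₃ , t₁ , t₂ , t₃)

  -- Signed relabelings are automorphisms

  ±R : Sign ℝ n → Permutation′ n → V → V
  ±R = signedRelabel ℝ n

  ±R-cong : ∀ s σ {x y} → x ≈ y → ±R s σ x ≈ ±R s σ y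
  ±R-cong plus σ x≈y (i , j , _) = ext-cong x≈y (σ ⟨$⟩ʳ i) (σ ⟨$⟩ʳ j)
  ±R-cong minus σ x≈y (i , j , _) = cong -_ (ext-cong x≈y (σ ⟨$⟩ʳ i) (σ ⟨$⟩ʳ j))

  -- Relabeling acts on indices by substitution, so the permutation of the outer map is applied
  -- first; `σ ∘ₚ τ` likewise applies `σ` first.
  ±R-∘ : ∀ s t σ τ x → ±R s σ (±R t τ x) ≈ ±R (s ·ₛ t) (σ ∘ₚ τ) x
  ±R-∘ plus plus σ τ x (i , j , _) = ext-relabel τ x (σ ⟨$⟩ʳ i) (σ ⟨$⟩ʳ j)
  ±R-∘ plus minus σ τ x (i , j , _) = trans (ext-neg (Relabel ℝ n τ x) (σ ⟨$⟩ʳ i) (σ ⟨$⟩ʳ j))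
    (cong -_ (ext-relabel τ x (σ ⟨$⟩ʳ i) (σ ⟨$⟩ʳ j)))
  ±R-∘ minus plus σ τ x (i , j , _) = cong -_ (ext-relabel τ x (σ ⟨$⟩ʳ i) (σ ⟨$⟩ʳ j))
  ±R-∘ minus minus σ τ x (i , j , _) = trans (cong -_ (ext-neg (Relabel ℝ n τ x) (σ ⟨$⟩ʳ i) (σ ⟨$⟩ʳ j)))
    (trans (-‿involutive _) (ext-relabel τ x (σ ⟨$⟩ʳ i) (σ ⟨$⟩ʳ j)))

  ±R-inverse : ∀ s σ τ → (∀ i → τ ⟨$⟩ʳ (σ ⟨$⟩ʳ i) ≡ i) → ∀ x → ±R s σ (±R s τ x) ≈ x
  ±R-inverse s σ τ inv x p@(i , j , i<j) = begin
    ±R s σ (±R s τ x) p                              ≡⟨ ±R-∘ s s σ τ x p ⟩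
    ±R (s ·ₛ s) (σ ∘ₚ τ) x p                         ≡⟨ cong (λ t → ±R t (σ ∘ₚ τ) x p) (square s) ⟩
    e x (τ ⟨$⟩ʳ (σ ⟨$⟩ʳ i)) (τ ⟨$⟩ʳ (σ ⟨$⟩ʳ j))      ≡⟨ cong₂ (e x) (inv i) (inv j) ⟩
    e x i j                                          ≡⟨ ext-< x i<j ⟩
    x p                                              ∎
    where
    square : ∀ (s : Sign ℝ n) → s ·ₛ s ≡ plus
    square plus = refl
    square minus = refl

  -- Squaring removes the signs caused by dualization and by pairs whose order `σ` inverts, so the
  -- squared terms are merely permuted.
  ±R-term : ∀ s σ x y p → term (±R s σ x) (±R s σ y) p ≡ term x y (permutePair σ p)
  ±R-term plus σ x y (i , j , i<j) with <-cmp (σ ⟨$⟩ʳ i) (σ ⟨$⟩ʳ j)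
  ... | tri< p _ _ = cong₂ (λ a b → (a + - b) * (a + - b)) (ext-< x p) (ext-< y p)
  ... | tri≈ _ eq _ = contradiction (permutation-injective σ eq) (Fin.<⇒≢ i<j)
  ... | tri> _ _ p = trans (cong₂ (λ a b → (a + - b) * (a + - b)) (ext-> x p) (ext-> y p))
    (solve 2 (λ a b → (:- a :- :- b) :* (:- a :- :- b) := (a :- b) :* (a :- b)) refl (x _) (y _))
  ±R-term minus σ x y p = trans
    (solve 2 (λ a b → (:- a :- :- b) :* (:- a :- :- b) := (a :- b) :* (a :- b)) refl (±R plus σ x p) (±R plus σ y p))
    (±R-term plus σ x y p)

  ±R-isometry : ∀ s σ → Isometry ℝ n (±R s σ)
  ±R-isometry s σ x y = begin
    d² (±R s σ x) (±R s σ y)                             ≡⟨ ∑-cong (allPairs n) (λ {p} _ → ±R-term s σ x y p) ⟩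
    ∑ (allPairs n) (λ p → term x y (permutePair σ p))    ≡⟨ cong sum (map-∘ (allPairs n)) ⟩
    ∑ (map (permutePair σ) (allPairs n)) (term x y)      ≡⟨ ∑-↭ (term x y) (allPairs-permuted σ) ⟩
    d² x y                                               ∎

  ±R-bijective : ∀ s σ → Bijective ℝ n (±R s σ)
  ±R-bijective s σ =
    (λ x y eq p → trans (sym (undo x p)) (trans (±R-cong s (flipₚ σ) eq p) (undo y p))) ,
    (λ y → ±R s (flipₚ σ) y , ±R-inverse s σ (flipₚ σ) (λ _ → inverseˡ σ) y)
    where
    undo : ∀ x → ±R s (flipₚ σ) (±R s σ x) ≈ x
    undo = ±R-inverse s (flipₚ σ) σ (λ _ → inverseʳ σ)

  relabeled-vertex : Sign ℝ n → Permutation′ n → Permutation′ n → Permutation′ n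
  relabeled-vertex plus σ π = σ ∘ₚ π
  relabeled-vertex minus σ π = dual (σ ∘ₚ π)

  ±R-vertex : ∀ s σ π → v (relabeled-vertex s σ π) ≈ ±R s σ (v π)
  ±R-vertex plus σ π (i , j , i<j) with <-cmp (π ⟨$⟩ʳ (σ ⟨$⟩ʳ i)) (π ⟨$⟩ʳ (σ ⟨$⟩ʳ j))
  ... | tri< lt _ _ = trans (sym (ext-< (v (σ ∘ₚ π)) i<j)) (trans (v-below (σ ∘ₚ π) lt) (sym (v-below π lt)))
  ... | tri≈ _ eq _ = contradiction (permutation-injective (σ ∘ₚ π) eq) (Fin.<⇒≢ i<j)
  ... | tri> _ _ gt = trans (sym (ext-< (v (σ ∘ₚ π)) i<j)) (trans (v-above (σ ∘ₚ π) gt) (sym (v-above π gt)))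
  ±R-vertex minus σ π p = trans (v-dual (σ ∘ₚ π) p) (cong -_ (±R-vertex plus σ π p))

  module _ (L : List (Permutation′ n × R)) {x : V} (x≡ : ∀ p → x p ≡ ∑ L (λ c → proj₂ c * v (proj₁ c) p)) where

    ext-∑ : ∀ i j → e x i j ≡ ∑ L (λ c → proj₂ c * e (v (proj₁ c)) i j)
    ext-∑ = ext-induction x _ anti diag (λ i j i<j → trans (x≡ (i , j , i<j))
        (∑-cong L (λ {c} _ → cong (proj₂ c *_) (sym (ext-< (v (proj₁ c)) i<j)))))
      where
      anti : ∀ i j → ∑ L (λ c → proj₂ c * e (v (proj₁ c)) j i) ≡ - ∑ L (λ c → proj₂ c * e (v (proj₁ c)) i j)
      anti i j = trans (∑-cong L (λ {c} _ → trans (cong (proj₂ c *_) (ext-antisym (v (proj₁ c)) i j))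
        (solve 2 (λ a b → a :* (:- b) := :- (a :* b)) refl (proj₂ c) (e (v (proj₁ c)) i j)))) (∑-neg L _)
      diag : ∀ i → ∑ L (λ c → proj₂ c * e (v (proj₁ c)) i i) ≡ 0#
      diag i = trans (∑-cong L (λ {c} _ → trans (cong (proj₂ c *_) (ext-diagonal (v (proj₁ c)) i)) (zeroʳ _)))
        (∑-zero L)

    ±R-∑ : ∀ s σ p → ±R s σ x p ≡ ∑ L (λ c → proj₂ c * ±R s σ (v (proj₁ c)) p)
    ±R-∑ plus σ (i , j , _) = ext-∑ (σ ⟨$⟩ʳ i) (σ ⟨$⟩ʳ j)
    ±R-∑ minus σ p@(i , j , _) = begin
      - e x (σ ⟨$⟩ʳ i) (σ ⟨$⟩ʳ j)                              ≡⟨ cong -_ (ext-∑ (σ ⟨$⟩ʳ i) (σ ⟨$⟩ʳ j)) ⟩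
      - ∑ L (λ c → proj₂ c * ±R plus σ (v (proj₁ c)) p)        ≡⟨ ∑-neg L _ ⟨
      ∑ L (λ c → - (proj₂ c * ±R plus σ (v (proj₁ c)) p))      ≡⟨ ∑-cong L (λ {c} _ →
        solve 2 (λ a b → :- (a :* b) := a :* (:- b)) refl (proj₂ c) (±R plus σ (v (proj₁ c)) p)) ⟩
      ∑ L (λ c → proj₂ c * ±R minus σ (v (proj₁ c)) p)         ∎

  ±R-into : ∀ s σ x → P x → P (±R s σ x)
  ±R-into s σ x (L , c≥0 , ∑c , x≡) = map g L , All.map⁺ c≥0 , trans (cong sum (sym (map-∘ L))) ∑c , λ p → begin
    ±R s σ x p                                                   ≡⟨ ±R-∑ L x≡ s σ p ⟩
    ∑ L (λ c → proj₂ c * ±R s σ (v (proj₁ c)) p)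
      ≡⟨ ∑-cong L (λ {c} _ → cong (proj₂ c *_) (sym (±R-vertex s σ (proj₁ c) p))) ⟩
    ∑ L (λ c → proj₂ c * v (relabeled-vertex s σ (proj₁ c)) p)   ≡⟨ cong sum (map-∘ L) ⟩
    ∑ (map g L) (λ c → proj₂ c * v (proj₁ c) p)                  ∎
    where
    g : Permutation′ n × R → Permutation′ n × R
    g (π , c) = relabeled-vertex s σ π , c

  ±R-automorphism : ∀ s σ → EuclideanAut ℝ n (±R s σ)
  ±R-automorphism s σ = ±R-isometry s σ , ±R-bijective s σ , ±R-into s σ ,
    λ y y∈P → ±R s (flipₚ σ) y , ±R-into s (flipₚ σ) y y∈P , ±R-inverse s σ (flipₚ σ) (λ _ → inverseˡ σ) y

  ext--R : ∀ σ x i j → e (±R minus σ x) i j ≡ e x (σ ⟨$⟩ʳ j) (σ ⟨$⟩ʳ i)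
  ext--R σ x i j = begin
    e (±R minus σ x) i j               ≡⟨ ext-neg (Relabel ℝ n σ x) i j ⟩
    - e (Relabel ℝ n σ x) i j          ≡⟨ cong -_ (ext-relabel σ x i j) ⟩
    - e x (σ ⟨$⟩ʳ i) (σ ⟨$⟩ʳ j)        ≡⟨ ext-antisym x (σ ⟨$⟩ʳ i) (σ ⟨$⟩ʳ j) ⟨
    e x (σ ⟨$⟩ʳ j) (σ ⟨$⟩ʳ i)          ∎

-- Uniqueness of the signed relabeling and classification

module _ (ℝ : CompleteOrderedField) (m : ℕ) where
  private
    n : ℕ
    n = suc (suc (suc m))
  open OrderedField ℝ
  open LinearOrderingPolytope ℝ n

  -- Comparing the arcs from `zero` to `j` would give `σ ⟨$⟩ʳ zero ≡ τ ⟨$⟩ʳ j` for every nonzero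
  -- `j`; two such `j` contradict the injectivity of `τ`.
  opposite-signs : ∀ σ τ → ¬ (∀ x → ±R plus σ x ≈ ±R minus τ x)
  opposite-signs σ τ eq = contradiction (permutation-injective τ (trans (sym (swapped (λ ()))) (swapped (λ ())))) 1≢2
    where
    1≢2 : _≢_ {A = Fin n} (suc zero) (suc (suc zero))
    1≢2 ()
    swapped : ∀ {j} → zero ≢ j → σ ⟨$⟩ʳ zero ≡ τ ⟨$⟩ʳ j
    swapped {j} 0≢j = proj₁ (vertices-separate-arcs {l′ = τ ⟨$⟩ʳ zero} (0≢j ∘ permutation-injective σ) (λ π →
      trans (sym (ext-relabel σ (v π) zero j)) (trans (ext-cong (eq (v π)) zero j) (ext--R τ (v π) zero j))))

  ±R-injective : ∀ s t σ τ → (∀ x → ±R s σ x ≈ ±R t τ x) → s ≡ t × (∀ i → σ ⟨$⟩ʳ i ≡ τ ⟨$⟩ʳ i)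
  ±R-injective plus plus σ τ eq = refl , λ i →
    let (j , j≢i , _) = avoid i i
    in proj₁ (vertices-separate-arcs {l′ = τ ⟨$⟩ʳ j} (j≢i ∘ sym ∘ permutation-injective σ) (λ π →
      trans (sym (ext-relabel σ (v π) i j)) (trans (ext-cong (eq (v π)) i j) (ext-relabel τ (v π) i j))))
  ±R-injective minus minus σ τ eq = refl , λ i →
    let (j , j≢i , _) = avoid i i
    in proj₁ (vertices-separate-arcs {l′ = τ ⟨$⟩ʳ j} (j≢i ∘ sym ∘ permutation-injective σ) (λ π →
      -- Dualization reverses arcs, so `(j , i)` is the arc whose image starts at `σ ⟨$⟩ʳ i`.
      trans (sym (ext--R σ (v π) j i)) (trans (ext-cong (eq (v π)) j i) (ext--R τ (v π) j i))))
  ±R-injective plus minus σ τ eq = ⊥-elim (opposite-signs σ τ eq)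
  ±R-injective minus plus σ τ eq = ⊥-elim (opposite-signs τ σ (λ x p → sym (eq x p)))

  automorphism⇒±R : (f : V → V) → EuclideanAut ℝ n f → ∃[ s ] ∃[ σ ] (∀ x → f x ≈ ±R s σ x)
  automorphism⇒±R f (isometry , _ , into , onto) = conclude
    (triangles⇒relabeling T (λ {a} {b} {k} {l} → T-rev {a} {b} {k} {l})
      (λ {a} {b} {k} {l} {k′} {l′} → T-functional {a} {b} {k} {l} {k′} {l′})
      (λ {a} {b} {k} → T-nondegenerate {a} {b} {k}) triangle)
    where
    open Automorphism f isometry into onto
    conclude : ∃[ σ ] ((∀ {i j} → i ≢ j → T i j (σ ⟨$⟩ʳ i) (σ ⟨$⟩ʳ j)) ⊎
                       (∀ {i j} → i ≢ j → T i j (σ ⟨$⟩ʳ j) (σ ⟨$⟩ʳ i))) →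
      ∃[ s ] ∃[ σ ] (∀ x → f x ≈ ±R s σ x)
    conclude (σ , inj₁ t) = plus , σ , λ { x (i , j , i<j) → trans (sym (ext-< (f x) i<j)) (t (Fin.<⇒≢ i<j) x) }
    conclude (σ , inj₂ t) = minus , σ , λ { x (i , j , i<j) → trans (sym (ext-< (f x) i<j))
      (trans (t (Fin.<⇒≢ i<j) x) (ext-antisym x (σ ⟨$⟩ʳ i) (σ ⟨$⟩ʳ j))) }

open import Data.Nat using (_≤_)

theorem6p2 : (ℝ : CompleteOrderedField) (n : ℕ) → 3 ≤ n →
  -- Aut(LO~_n) = { ± R_σ : σ ∈ S_n }
  ((f : Vec ℝ n → Vec ℝ n) →
    EuclideanAut ℝ n f →
    ∃[ s ] ∃[ σ ] (∀ x → _≈V_ ℝ n (f x) (signedRelabel ℝ n s σ x)))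
  × ((s : Sign ℝ n) (σ : Permutation′ n) →
    EuclideanAut ℝ n (signedRelabel ℝ n s σ))
  -- (s, σ) ↦ s·R_σ is injective ...
  × ((s t : Sign ℝ n) (σ τ : Permutation′ n) →
    (∀ x → _≈V_ ℝ n (signedRelabel ℝ n s σ x) (signedRelabel ℝ n t τ x)) →
    (s ≡ t) × (∀ i → σ ⟨$⟩ʳ i ≡ τ ⟨$⟩ʳ i))
  -- ... and multiplicative: (s·R_σ) ∘ (t·R_τ) = (s t)·R_{τ∘σ},
  -- so (s, σ) ↦ s·R_{σ⁻¹} is an isomorphism ℤ₂ × S_n ≅ Aut(LO~_n)
  × ((s t : Sign ℝ n) (σ τ : Permutation′ n) (x : Vec ℝ n) →
    _≈V_ ℝ n (signedRelabel ℝ n s σ (signedRelabel ℝ n t τ x))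
             (signedRelabel ℝ n (s ·ₛ t) (σ ∘ₚ τ) x))
theorem6p2 ℝ (suc (suc (suc m))) (s≤s (s≤s (s≤s _))) =
  automorphism⇒±R ℝ m , ±R-automorphism , ±R-injective ℝ m , ±R-∘
  where open LinearOrderingPolytope ℝ (suc (suc (suc m)))
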